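{- Let $F$ be a field in which $3$ is invertible, let $D\in \mathrm{Der}_{\mathbb Z}(F)$ be an absolute derivation, and let $V_3$ be a $3$-dimensional $F$-vector space with a fixed volume form. Then the square $$\begin{array}{ccc} C_5(3) & \xrightarrow{\;d\;} & C_4(3)\\ {\scriptstyle\tau^3_1}\downarrow & & \downarrow{\scriptstyle\tau^3_0}\\ \left(\beta^D_2(F)\otimes F^\times\right)\oplus\left(F\otimes \mathcal{B}_2(F)\right) & \xrightarrow{\;\partial^D\;} & F\otimes\bigwedge^2F^\times\end{array}$$ is commutative (modulo $2$-torsion), i.e. $\tau_0^{3}\circ d=\partial^D\circ\tau_1^{3}$ on $C_5(3)$.
   Context: All tensor products are over $\mathbb Z$; $F\otimes A$ is an $F$-vector space via the left factor. $F^{\bullet\bullet}=F\setminus\{0,1\}$. A derivation $D\in\mathrm{Der}_{\mathbb Z}(F)$ is an additive map $D:F\to F$ with $D(ab)=aD(b)+bD(a)$; $D\log a:=D(a)/a$. $\bigwedge^2F^\times=F^\times\otimes F^\times/\langle x\otimes x\rangle$. All identities are understood modulo $2$-torsion. The group $\mathcal B_2(F)$: $\mathbb Z[\mathbb P^1_F\setminus\{0,1,\infty\}]$ modulo the subgroup generated by $\sum_{i=0}^4(-1)^i[r(x_0,\ldots,\hat x_i,\ldots,x_4)]$ for distinct $x_0,\ldots,x_4\in\mathbb P^1_F$, with $r(x_0,x_1,x_2,x_3)=\frac{(x_0-x_3)(x_1-x_2)}{(x_0-x_2)(x_1-x_3)}$; $[x]_2$ is the class of $[x]$. The space $\beta_2(F)$: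 $F[F^{\bullet\bullet}]$ (the $F$-vector space with basis $[a]$, $a\in F^{\bullet\bullet}$) modulo the kernel of the $F$-linear map $F[F^{\bullet\bullet}]\to F\otimes F^\times$, $[a]\mapsto a\otimes a+(1-a)\otimes(1-a)$; $\langle a\rangle_2$ is the class of $[a]$. Put $\llbracket a\rrbracket^D_2=\frac{D(a)}{a(1-a)}\langle a\rangle_2$, and let $\beta^D_2(F)\subset\beta_2(F)$ be the $F$-subspace generated by all $\llbracket a\rrbracket^D_2$, $a\in F^{\bullet\bullet}$. The map $\partial^D:(\beta^D_2(F)\otimes F^\times)\oplus(F\otimes\mathcal B_2(F))\to F\otimes\bigwedge^2F^\times$ is the $F$-linear map $$\partial^D\left(\llbracket a\rrbracket^D_2\otimes b+x\otimes[y]_2\right)=D\log(1-a)\otimes a\wedge b-D\log(a)\otimes(1-a)\wedge b+x\otimes(1-y)\wedge y.$$ Configurations: $C_m(3)$ is the free abelian group generated by $m$-tuples of vectors $(l_0,\ldots,l_{m-1})$ in $V_3$ in generic position (any $3$ or fewer of them are linearly independent), modulo the diagonal action of $GL(V_3)$. $d(l_0,\ldots,l_{m-1})=\sum_{i=0}^{m-1}(-1)^i(l_0,\ldots,\hat l_i,\ldots,l_{m-1})$. With $\omega\in\det V_3^*$ the volume form, $\Delta(l_i,l_j,l_k)=\langle\omega,l_i\wedge l_j\wedge l_k\rangle$. Projected cross-ratio: $r(l_0|l_1,l_2,l_3,l_4)=\frac{\Delta(l_0,l_1,l_4)\Delta(l_0,l_2,l_3)}{\Delta(l_0,l_1,l_3)\Delta(l_0,l_2,l_4)}$.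 For a $5$-tuple $(l_0,\ldots,l_4)$, $\Delta(\hat l_i,\hat l_j)$ denotes the determinant $\Delta$ of the three vectors remaining (in order) after deleting $l_i$ and $l_j$. The maps: $$\tau_0^{3}(l_0,\ldots,l_3)=\sum_{i=0}^3(-1)^{i}D\log\Delta(l_0,\ldots,\hat l_i,\ldots,l_3)\otimes\frac{\Delta(l_0,\ldots,\hat l_{i+1},\ldots,l_3)}{\Delta(l_0,\ldots,\hat l_{i+2},\ldots,l_3)}\wedge\frac{\Delta(l_0,\ldots,\hat l_{i+3},\ldots,l_3)}{\Delta(l_0,\ldots,\hat l_{i+2},\ldots,l_3)}$$ (indices mod $4$), and $$\tau_1^{3}(l_0,\ldots,l_4)=-\frac13\sum_{i=0}^4(-1)^i\Big\{\llbracket r(l_i|l_0,\ldots,\hat l_i,\ldots,l_4)\rrbracket^D_2\otimes\prod_{j\ne i}\Delta(\hat l_i,\hat l_j)+D\log\Big(\prod_{j\neq i}\Delta(\hat l_i,\hat l_j)\Big)\otimes[r(l_i|l_0,\ldots,\hat l_i,\ldots,l_4)]_2\Big\}.$$ -}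

module Defs where

open import Level using (Level; _⊔_)
open import Algebra.Apartness.Bundles using (HeytingField; HeytingCommutativeRing)
open import Algebra.Bundles using (AbelianGroup; CommutativeRing; Ring)
open import Algebra.Module.Bundles using (LeftModule)
open import Algebra.Module.Morphism.Structures using (module LeftModuleMorphisms)
open import Data.Fin.Base using (Fin; toℕ; punchIn) renaming (suc to fsuc)
open import Data.Fin.Patterns using (0F; 1F; 2F; 3F; 4F)
open import Data.Fin.Properties using (_≟_; punchIn-injective; punchInᵢ≢i)
open import Data.Nat.Base as ℕ using (ℕ; zero; _≤_)
open import Data.Nat.Properties using (≤-refl)
open import Data.Nat.DivMod using (_mod_)
open import Data.Product.Base using (_,_; proj₁; proj₂; ∃-syntax)
open import Data.Product.Relation.Binary.Pointwise.NonDependent using (_×ₛ_)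
open import Data.Sum.Base using (_⊎_; inj₁; inj₂; [_,_]′)
open import Function.Base using (_∘_; _on_)
open import Function.Definitions using (Injective)
open import Relation.Binary.Bundles using (Setoid)
open import Relation.Binary.Construct.Never using (Never)
open import Relation.Binary.Core using (Rel)
open import Relation.Binary.PropositionalEquality.Core using (_≡_; _≢_)
import Relation.Binary.PropositionalEquality.Core as ≡
open import Relation.Nullary.Decidable using (False; toWitnessFalse)
open import Relation.Nullary.Negation using (contradiction)
import Algebra.Apartness.Properties.HeytingCommutativeRing as HeytingProperties
import Algebra.Module.Construct.DirectProduct as DirectProduct
import Algebra.Module.Construct.TensorUnit as TensorUnit
import Algebra.Properties.CommutativeMonoid.Sum as Sum
import Algebra.Properties.Ring as RingProperties
import Algebra.Solver.Ring.NaturalCoefficients.Default as SemiringSolver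
import Relation.Binary.Reasoning.Setoid as SetoidReasoning

------------------------------------------------------------------------
-- Abelian groups and modules presented by generators and relations.
--
-- Elements of a presented object are formal expressions in the generators,
-- identified by the congruence generated by the axioms and the relations.
-- A homomorphism out of a presented object is given by its values on
-- generators and computed on expressions by `extend`; that it respects the
-- relations is not part of the definition, so identities between such maps
-- are asserted for every expression, i.e. for every representative.

module AbelianPresentation {x ℓx : Level} (X : Setoid x ℓx) where
  private module X = Setoid X

  infixl 6 _+ᵗ_
  infix  8 -ᵗ_

  data Term : Set x where
    gen  : X.Carrier → Term
    0ᵗ   : Term
    _+ᵗ_ : Term → Term → Term
    -ᵗ_  : Term → Term

  data Eq {ρ : Level} (R : Rel Term ρ) : Rel Term (x ⊔ ℓx ⊔ ρ) where
    relation  : ∀ {s t} → R s t → Eq R s t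
    gen-cong  : ∀ {a b} → a X.≈ b → Eq R (gen a) (gen b)
    refl      : ∀ {s} → Eq R s s
    sym       : ∀ {s t} → Eq R s t → Eq R t s
    trans     : ∀ {s t u} → Eq R s t → Eq R t u → Eq R s u
    +-cong    : ∀ {s s′ t t′} → Eq R s s′ → Eq R t t′ → Eq R (s +ᵗ t) (s′ +ᵗ t′)
    neg-cong  : ∀ {s s′} → Eq R s s′ → Eq R (-ᵗ s) (-ᵗ s′)
    assoc     : ∀ s t u → Eq R ((s +ᵗ t) +ᵗ u) (s +ᵗ (t +ᵗ u))
    comm      : ∀ s t → Eq R (s +ᵗ t) (t +ᵗ s)
    identityˡ : ∀ s → Eq R (0ᵗ +ᵗ s) s
    inverseˡ  : ∀ s → Eq R ((-ᵗ s) +ᵗ s) 0ᵗ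

  presented : {ρ : Level} → Rel Term ρ → AbelianGroup x (x ⊔ ℓx ⊔ ρ)
  presented R = record
    { Carrier = Term
    ; _≈_ = Eq R
    ; _∙_ = _+ᵗ_
    ; ε = 0ᵗ
    ; _⁻¹ = -ᵗ_
    ; isAbelianGroup = record
      { isGroup = record
        { isMonoid = record
          { isSemigroup = record
            { isMagma = record
              { isEquivalence = record { refl = refl ; sym = sym ; trans = trans }
              ; ∙-cong = +-cong
              }
            ; assoc = assoc
            }
          ; identity = identityˡ , λ s → trans (comm s 0ᵗ) (identityˡ s)
          }
        ; inverse = inverseˡ , λ s → trans (comm s (-ᵗ s)) (inverseˡ s)
        ; ⁻¹-cong = neg-cong
        }
      ; comm = comm
      }
    }

  free : AbelianGroup x (x ⊔ ℓx)
  free = presented (Never {ℓ = x})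

  extend : {g ℓg : Level} (G : AbelianGroup g ℓg) →
           (X.Carrier → AbelianGroup.Carrier G) → Term → AbelianGroup.Carrier G
  extend G f = go
    where
    open AbelianGroup G
    go : Term → Carrier
    go (gen a)  = f a
    go 0ᵗ       = ε
    go (s +ᵗ t) = go s ∙ go t
    go (-ᵗ s)   = go s ⁻¹

module ModulePresentation {r ℓr x ℓx : Level} (K : Ring r ℓr) (X : Setoid x ℓx) where
  private
    module K = Ring K
    module X = Setoid X

  infixl 6 _+ᵗ_
  infixr 7 _·ᵗ_
  infix  8 -ᵗ_

  data Term : Set (r ⊔ x) where
    gen  : X.Carrier → Term
    0ᵗ   : Term
    _+ᵗ_ : Term → Term → Term
    -ᵗ_  : Term → Term
    _·ᵗ_ : K.Carrier → Term → Term

  data Eq {ρ : Level} (R : Rel Term ρ) : Rel Term (r ⊔ ℓr ⊔ x ⊔ ℓx ⊔ ρ) where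
    relation   : ∀ {s t} → R s t → Eq R s t
    gen-cong   : ∀ {a b} → a X.≈ b → Eq R (gen a) (gen b)
    refl       : ∀ {s} → Eq R s s
    sym        : ∀ {s t} → Eq R s t → Eq R t s
    trans      : ∀ {s t u} → Eq R s t → Eq R t u → Eq R s u
    +-cong     : ∀ {s s′ t t′} → Eq R s s′ → Eq R t t′ → Eq R (s +ᵗ t) (s′ +ᵗ t′)
    neg-cong   : ∀ {s s′} → Eq R s s′ → Eq R (-ᵗ s) (-ᵗ s′)
    ·-cong     : ∀ {k k′ s s′} → k K.≈ k′ → Eq R s s′ → Eq R (k ·ᵗ s) (k′ ·ᵗ s′)
    assoc      : ∀ s t u → Eq R ((s +ᵗ t) +ᵗ u) (s +ᵗ (t +ᵗ u))
    comm       : ∀ s t → Eq R (s +ᵗ t) (t +ᵗ s)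
    identityˡ  : ∀ s → Eq R (0ᵗ +ᵗ s) s
    inverseˡ   : ∀ s → Eq R ((-ᵗ s) +ᵗ s) 0ᵗ
    ·-zeroˡ    : ∀ s → Eq R (K.0# ·ᵗ s) 0ᵗ
    ·-zeroʳ    : ∀ k → Eq R (k ·ᵗ 0ᵗ) 0ᵗ
    ·-distribʳ : ∀ s k k′ → Eq R ((k K.+ k′) ·ᵗ s) (k ·ᵗ s +ᵗ k′ ·ᵗ s)
    ·-distribˡ : ∀ k s t → Eq R (k ·ᵗ (s +ᵗ t)) (k ·ᵗ s +ᵗ k ·ᵗ t)
    ·-identity : ∀ s → Eq R (K.1# ·ᵗ s) s
    ·-assoc    : ∀ k k′ s → Eq R ((k K.* k′) ·ᵗ s) (k ·ᵗ (k′ ·ᵗ s))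

  presented : {ρ : Level} → Rel Term ρ → LeftModule K (r ⊔ x) (r ⊔ ℓr ⊔ x ⊔ ℓx ⊔ ρ)
  presented R = record
    { Carrierᴹ = Term
    ; _≈ᴹ_ = Eq R
    ; _+ᴹ_ = _+ᵗ_
    ; _*ₗ_ = _·ᵗ_
    ; 0ᴹ = 0ᵗ
    ; -ᴹ_ = -ᵗ_
    ; isLeftModule = record
      { isLeftSemimodule = record
        { +ᴹ-isCommutativeMonoid = record
          { isMonoid = record
            { isSemigroup = record
              { isMagma = record
                { isEquivalence = record { refl = refl ; sym = sym ; trans = trans }
                ; ∙-cong = +-cong
                }
              ; assoc = assoc
              }
            ; identity = identityˡ , λ s → trans (comm s 0ᵗ) (identityˡ s)
            }
          ; comm = comm
          }
        ; isPreleftSemimodule = record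
          { *ₗ-cong = ·-cong
          ; *ₗ-zeroˡ = ·-zeroˡ
          ; *ₗ-distribʳ = ·-distribʳ
          ; *ₗ-identityˡ = ·-identity
          ; *ₗ-assoc = ·-assoc
          ; *ₗ-zeroʳ = ·-zeroʳ
          ; *ₗ-distribˡ = ·-distribˡ
          }
        }
      ; -ᴹ‿cong = neg-cong
      ; -ᴹ‿inverse = inverseˡ , λ s → trans (comm s (-ᵗ s)) (inverseˡ s)
      }
    }

  extend : {m ℓm : Level} (M : LeftModule K m ℓm) →
           (X.Carrier → LeftModule.Carrierᴹ M) → Term → LeftModule.Carrierᴹ M
  extend M f = go
    where
    open LeftModule M
    go : Term → Carrierᴹ
    go (gen a)  = f a
    go 0ᵗ       = 0ᴹ
    go (s +ᵗ t) = go s +ᴹ go t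
    go (-ᵗ s)   = -ᴹ go s
    go (k ·ᵗ s) = k *ₗ go s

  -- The submodule generated by a family f, as the image of the free module
  -- on the index setoid: two combinations are equal when their values are.
  spanned : {m ℓm : Level} (M : LeftModule K m ℓm) →
            (X.Carrier → LeftModule.Carrierᴹ M) →
            LeftModule K (r ⊔ x) (r ⊔ ℓr ⊔ x ⊔ ℓx ⊔ ℓm)
  spanned M f = presented (LeftModule._≈ᴹ_ M on extend M f)

-- The tensor product over ℤ of a K-module M with an abelian group A, with K
-- acting on the left factor.  It is presented as a K-module, so besides
-- biadditivity there is the relation (k m) ⊗ a = k (m ⊗ a) defining the action.
module Tensor {r ℓr m ℓm a ℓa : Level} {K : Ring r ℓr}
              (M : LeftModule K m ℓm) (A : AbelianGroup a ℓa) where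
  private
    module K = Ring K
    module M = LeftModule M
    module A = AbelianGroup A

  open ModulePresentation K (M.≈ᴹ-setoid ×ₛ A.setoid)

  data Bilinear : Rel Term (r ⊔ m ⊔ a) where
    additiveˡ : ∀ v v′ x → Bilinear (gen (v M.+ᴹ v′ , x)) (gen (v , x) +ᵗ gen (v′ , x))
    additiveʳ : ∀ v x x′ → Bilinear (gen (v , x A.∙ x′)) (gen (v , x) +ᵗ gen (v , x′))
    scalar    : ∀ k v x → Bilinear (gen (k M.*ₗ v , x)) (k ·ᵗ gen (v , x))

  tensor : LeftModule K (r ⊔ m ⊔ a) (r ⊔ ℓr ⊔ m ⊔ ℓm ⊔ a ⊔ ℓa)
  tensor = presented Bilinear

  infix 7 _⊗_
  _⊗_ : M.Carrierᴹ → A.Carrier → Term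
  m ⊗ a = gen (m , a)

  -- Extension of a K-linear-in-m, additive-in-a assignment m ⊗ a ↦ f m a.
  extend⊗ : {n ℓn : Level} (N : LeftModule K n ℓn) →
            (M.Carrierᴹ → A.Carrier → LeftModule.Carrierᴹ N) →
            Term → LeftModule.Carrierᴹ N
  extend⊗ N f = extend N λ (m , a) → f m a

-- ⋀² A = A ⊗ A / ⟨ x ⊗ x ⟩.
module ExteriorSquare {a ℓa : Level} (A : AbelianGroup a ℓa) where
  private module A = AbelianGroup A

  open AbelianPresentation (A.setoid ×ₛ A.setoid)

  data Alternating : Rel Term a where
    additiveˡ   : ∀ x x′ y → Alternating (gen (x A.∙ x′ , y)) (gen (x , y) +ᵗ gen (x′ , y))
    additiveʳ   : ∀ x y y′ → Alternating (gen (x , y A.∙ y′)) (gen (x , y) +ᵗ gen (x , y′))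
    alternating : ∀ x → Alternating (gen (x , x)) 0ᵗ

  ⋀² : AbelianGroup a (a ⊔ ℓa)
  ⋀² = presented Alternating

  infix 8 _∧_
  _∧_ : A.Carrier → A.Carrier → Term
  x ∧ y = gen (x , y)

module _ {g ℓg : Level} (G : AbelianGroup g ℓg) where
  open AbelianGroup G

  sign : ℕ → Carrier → Carrier
  sign zero      x = x
  sign (ℕ.suc n) x = sign n x ⁻¹

  -- Σᵢ (-1)ⁱ f i
  altSum : {n : ℕ} → (Fin n → Carrier) → Carrier
  altSum f = Sum.sum commutativeMonoid λ i → sign (toℕ i) (f i)

  -- x - y is killed by 2.
  infix 4 EqualMod2Torsion
  EqualMod2Torsion : Rel Carrier ℓg
  EqualMod2Torsion x y = (x - y) ∙ (x - y) ≈ ε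

  syntax EqualMod2Torsion G x y = x ≈ y mod2 G

------------------------------------------------------------------------
-- Fields.  The field is a Heyting field, so "nonzero" and "distinct" are
-- expressed with the apartness _#_ rather than with the negation of _≈_;
-- for a field in the classical sense, x # y is x ≉ y.

module Field {c ℓ₁ ℓ₂ : Level} (F : HeytingField c ℓ₁ ℓ₂) where
  open HeytingField F public
    using (_#_; #-sym; #-cotrans; #⇒invertible; heytingCommutativeRing)
  open HeytingCommutativeRing heytingCommutativeRing public using (commutativeRing)
  open CommutativeRing commutativeRing public
  open HeytingProperties heytingCommutativeRing public
    using (invertibleˡ⇒#; x-0≈x; 1#0; x#0y#0→xy#0; #-congʳ; #-congˡ)
  open SetoidReasoning setoid
  private
    module S = SemiringSolver commutativeSemiring
    open S using (solve; _:=_; _:+_; _:*_)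
    module RP = RingProperties ring

  record NonZero : Set (c ⊔ ℓ₂) where
    constructor nonZero
    field
      val   : Carrier
      val#0 : val # 0#
  open NonZero public

  leftInverse#0 : ∀ x {y} → y * x ≈ 1# → x # 0#
  leftInverse#0 x {y} yx≈1 = invertibleˡ⇒# (y , trans (*-congˡ (x-0≈x x)) yx≈1)

  inverse : (x : NonZero) → ∃[ y ] y * val x ≈ 1#
  inverse (nonZero x x#0) = let (y , y[x-0]≈1 , _) = #⇒invertible x#0 in
    y , trans (*-congˡ (sym (x-0≈x x))) y[x-0]≈1

  _⁻¹ : NonZero → NonZero
  x ⁻¹ = let (y , yx≈1) = inverse x in
    nonZero y (leftInverse#0 y (trans (*-comm (val x) y) yx≈1))

  ⁻¹-inverseˡ : ∀ x → val (x ⁻¹) * val x ≈ 1#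
  ⁻¹-inverseˡ x = proj₂ (inverse x)

  F× : AbelianGroup (c ⊔ ℓ₂) ℓ₁
  F× = record
    { Carrier = NonZero
    ; _≈_ = λ x y → val x ≈ val y
    ; _∙_ = λ x y → nonZero (val x * val y) (x#0y#0→xy#0 (val#0 x) (val#0 y))
    ; ε = nonZero 1# 1#0
    ; _⁻¹ = _⁻¹
    ; isAbelianGroup = record
      { isGroup = record
        { isMonoid = record
          { isSemigroup = record
            { isMagma = record
              { isEquivalence = record { refl = refl ; sym = sym ; trans = trans }
              ; ∙-cong = *-cong
              }
            ; assoc = λ x y z → *-assoc (val x) (val y) (val z)
            }
          ; identity = (λ x → *-identityˡ (val x)) , (λ x → *-identityʳ (val x))
          }
        ; inverse = ⁻¹-inverseˡ , λ x → trans (*-comm (val x) _) (⁻¹-inverseˡ x)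
        ; ⁻¹-cong = λ {x} {y} → inv-cong x y
        }
      ; comm = λ x y → *-comm (val x) (val y)
      }
    }
    where
    inv-cong : ∀ x y → val x ≈ val y → val (x ⁻¹) ≈ val (y ⁻¹)
    inv-cong x y x≈y = begin
      val (x ⁻¹)                          ≈⟨ *-identityʳ _ ⟨
      val (x ⁻¹) * 1#                     ≈⟨ *-congˡ (⁻¹-inverseˡ y) ⟨
      val (x ⁻¹) * (val (y ⁻¹) * val y)   ≈⟨ *-congˡ (*-congˡ x≈y) ⟨
      val (x ⁻¹) * (val (y ⁻¹) * val x)   ≈⟨ solve 3 (λ a b z → a :* (b :* z) := (a :* z) :* b) refl _ _ _ ⟩
      (val (x ⁻¹) * val x) * val (y ⁻¹)   ≈⟨ *-congʳ (⁻¹-inverseˡ x) ⟩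
      1# * val (y ⁻¹)                     ≈⟨ *-identityˡ _ ⟩
      val (y ⁻¹)                          ∎

  infixl 7 _∙_ _/_
  _∙_ _/_ : NonZero → NonZero → NonZero
  _∙_ = AbelianGroup._∙_ F×
  _/_ = AbelianGroup._-_ F×

  #⇒-#0 : ∀ {x y} → x # y → x - y # 0#
  #⇒-#0 {x} {y} x#y = let (z , z[x-y]≈1 , _) = #⇒invertible x#y in
    leftInverse#0 (x - y) z[x-y]≈1

  -#0⇒# : ∀ {x y} → x - y # 0# → x # y
  -#0⇒# x-y#0 = invertibleˡ⇒# (inverse (nonZero _ x-y#0))

  factor#0 : ∀ {x y} → x * y # 0# → x # 0#
  factor#0 {x} {y} xy#0 = let (z , z[xy]≈1) = inverse (nonZero (x * y) xy#0) in
    leftInverse#0 x {z * y}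
      (trans (solve 3 (λ x y z → (z :* y) :* x := z :* (x :* y)) refl x y z) z[xy]≈1)

  summand#0 : ∀ {x y} → x + y # 0# → x # 0# ⊎ y # 0#
  summand#0 {x} {y} x+y#0 with #-cotrans x+y#0 x
  ... | inj₂ x#0   = inj₁ x#0
  ... | inj₁ x+y#x = inj₂ (#-congʳ x+y-x≈y (#⇒-#0 x+y#x))
    where
    x+y-x≈y : x + y - x ≈ y
    x+y-x≈y = begin
      x + y - x   ≈⟨ +-congʳ (+-comm x y) ⟩
      y + x - x   ≈⟨ +-assoc y x (- x) ⟩
      y + (x - x) ≈⟨ +-congˡ (-‿inverseʳ x) ⟩
      y + 0#      ≈⟨ +-identityʳ y ⟩
      y           ∎

  difference-+ : ∀ {a a′ b b′ c c′} → a + b + c′ ≈ a′ + b′ + c →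
                 (a - a′) + (b - b′) ≈ c - c′
  difference-+ {a} {a′} {b} {b′} {c} {c′} eq = begin
    (a - a′) + (b - b′)
      ≈⟨ +-identityʳ _ ⟨
    (a - a′) + (b - b′) + 0#
      ≈⟨ +-congˡ (-‿inverseʳ c′) ⟨
    (a - a′) + (b - b′) + (c′ - c′)
      ≈⟨ solve 6 (λ a a⁻ b b⁻ c c⁻ → (a :+ a⁻) :+ (b :+ b⁻) :+ (c :+ c⁻)
                                     := (a :+ b :+ c) :+ (a⁻ :+ b⁻ :+ c⁻)) refl
               a (- a′) b (- b′) c′ (- c′) ⟩
    (a + b + c′) + (- a′ - b′ - c′)
      ≈⟨ +-congʳ eq ⟩
    (a′ + b′ + c) + (- a′ - b′ - c′)
      ≈⟨ solve 6 (λ a a⁻ b b⁻ c c⁻ → (a :+ b :+ c) :+ (a⁻ :+ b⁻ :+ c⁻)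
                                     := (a :+ a⁻) :+ (b :+ b⁻) :+ (c :+ c⁻)) refl
               a′ (- a′) b′ (- b′) c (- c′) ⟩
    (a′ - a′) + (b′ - b′) + (c - c′)
      ≈⟨ +-congʳ (+-cong (-‿inverseʳ a′) (-‿inverseʳ b′)) ⟩
    0# + 0# + (c - c′)
      ≈⟨ +-congʳ (+-identityˡ 0#) ⟩
    0# + (c - c′)
      ≈⟨ +-identityˡ _ ⟩
    c - c′ ∎

  difference-* : ∀ a b c d → (a - b) * (c - d) ≈ (a * c + b * d) - (a * d + b * c)
  difference-* a b c d = begin
    (a - b) * (c - d)
      ≈⟨ solve 4 (λ a b c d → (a :+ b) :* (c :+ d) := (a :* c :+ b :* d) :+ (a :* d :+ b :* c))
               refl a (- b) c (- d) ⟩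
    (a * c + (- b) * (- d)) + (a * (- d) + (- b) * c)
      ≈⟨ +-cong (+-congˡ (trans (sym (RP.-‿distribˡ-* b (- d)))
                           (trans (-‿cong (sym (RP.-‿distribʳ-* b d))) (RP.-‿involutive _))))
                (+-cong (sym (RP.-‿distribʳ-* a d)) (sym (RP.-‿distribˡ-* b c))) ⟩
    (a * c + b * d) + (- (a * d) - b * c)
      ≈⟨ +-congˡ (RP.-‿+-comm (a * d) (b * c)) ⟩
    (a * c + b * d) - (a * d + b * c) ∎

  record Derivation : Set (c ⊔ ℓ₁) where
    field
      D       : Carrier → Carrier
      D-cong  : ∀ {x y} → x ≈ y → D x ≈ D y
      D-+     : ∀ x y → D (x + y) ≈ D x + D y
      leibniz : ∀ x y → D (x * y) ≈ x * D y + y * D x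

    Dlog : NonZero → Carrier
    Dlog a = D (val a) * val (a ⁻¹)

  -- F \ {0, 1}
  record F•• : Set (c ⊔ ℓ₂) where
    constructor f••
    field
      unit  : NonZero
      unit#1 : val unit # 1#

    one-minus : NonZero
    one-minus = nonZero (1# - val unit) (#⇒-#0 (#-sym unit#1))
  open F•• public

  F••-setoid : Setoid (c ⊔ ℓ₂) ℓ₁
  F••-setoid = record
    { Carrier = F••
    ; _≈_ = λ a b → val (unit a) ≈ val (unit b)
    ; isEquivalence = record { refl = refl ; sym = sym ; trans = trans }
    }

  -- n / m is different from 1 when m - n is nonzero.
  ratio : (n m k : NonZero) → val k + val n ≈ val m → F••
  ratio n m k k+n≈m = f•• (n / m) (#-sym (-#0⇒# (#-congʳ k/m≈1-n/m (val#0 (k / m)))))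
    where
    m⁻¹ = val (m ⁻¹)
    k/m≈1-n/m : val k * m⁻¹ ≈ 1# - val n * m⁻¹
    k/m≈1-n/m = begin
      val k * m⁻¹                                   ≈⟨ +-identityʳ _ ⟨
      val k * m⁻¹ + 0#                              ≈⟨ +-congˡ (-‿inverseʳ _) ⟨
      val k * m⁻¹ + (val n * m⁻¹ - val n * m⁻¹)     ≈⟨ +-assoc _ _ _ ⟨
      val k * m⁻¹ + val n * m⁻¹ - val n * m⁻¹       ≈⟨ +-congʳ (distribʳ _ _ _) ⟨
      (val k + val n) * m⁻¹ - val n * m⁻¹           ≈⟨ +-congʳ (*-congʳ k+n≈m) ⟩
      val m * m⁻¹ - val n * m⁻¹                     ≈⟨ +-congʳ (*-comm _ _) ⟩
      m⁻¹ * val m - val n * m⁻¹                     ≈⟨ +-congʳ (⁻¹-inverseˡ m) ⟩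
      1# - val n * m⁻¹                              ∎

  ----------------------------------------------------------------------
  -- The cross-ratio on the projective line.

  -- A point is given by homogeneous coordinates [ p ∶ q ], standing for p / q,
  -- and ∞ = [ 1 ∶ 0 ].
  record ℙ¹ : Set (c ⊔ ℓ₂) where
    field
      p q     : Carrier
      nonzero : p # 0# ⊎ q # 0#
  open ℙ¹

  -- The difference p/q - p′/q′ multiplied by q q′; these factors cancel in
  -- cross-ratios, which extends the usual formula to the point ∞.
  _⊖_ : ℙ¹ → ℙ¹ → Carrier
  x ⊖ y = p x * q y - q x * p y

  Distinct : ℙ¹ → ℙ¹ → Set ℓ₂
  Distinct x y = x ⊖ y # 0#

  -- r(x₀,x₁,x₂,x₃) = (x₀-x₃)(x₁-x₂) / (x₀-x₂)(x₁-x₃)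
  cross-ratio : (x : Fin 4 → ℙ¹) → (∀ {i j} → i ≢ j → Distinct (x i) (x j)) → F••
  cross-ratio x distinct = ratio
    (diff 0F 3F ∙ diff 1F 2F)
    (diff 0F 2F ∙ diff 1F 3F)
    (diff 0F 1F ∙ diff 2F 3F)
    plücker
    where
    diff : (i j : Fin 4) {i≢j : False (i ≟ j)} → NonZero
    diff i j {i≢j} = nonZero (x i ⊖ x j) (distinct (toWitnessFalse i≢j))

    plücker : (x 0F ⊖ x 1F) * (x 2F ⊖ x 3F) + (x 0F ⊖ x 3F) * (x 1F ⊖ x 2F)
              ≈ (x 0F ⊖ x 2F) * (x 1F ⊖ x 3F)
    plücker = trans
      (+-cong (difference-* _ _ _ _) (difference-* _ _ _ _))
      (trans
        (difference-+ (solve 8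
          (λ p₀ q₀ p₁ q₁ p₂ q₂ p₃ q₃ →
             ((p₀ :* q₁) :* (p₂ :* q₃) :+ (q₀ :* p₁) :* (q₂ :* p₃))
             :+ ((p₀ :* q₃) :* (p₁ :* q₂) :+ (q₀ :* p₃) :* (q₁ :* p₂))
             :+ ((p₀ :* q₂) :* (q₁ :* p₃) :+ (q₀ :* p₂) :* (p₁ :* q₃))
             := ((p₀ :* q₁) :* (q₂ :* p₃) :+ (q₀ :* p₁) :* (p₂ :* q₃))
             :+ ((p₀ :* q₃) :* (q₁ :* p₂) :+ (q₀ :* p₃) :* (p₁ :* q₂))
             :+ ((p₀ :* q₂) :* (p₁ :* q₃) :+ (q₀ :* p₂) :* (q₁ :* p₃)))
          refl (p (x 0F)) (q (x 0F)) (p (x 1F)) (q (x 1F))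
               (p (x 2F)) (q (x 2F)) (p (x 3F)) (q (x 3F))))
        (sym (difference-* _ _ _ _)))

  ----------------------------------------------------------------------
  -- The groups B₂(F) and β₂(F).

  open AbelianPresentation F••-setoid using ()
    renaming (Term to ℤ[F••]; gen to ℤ-gen; presented to ℤ-presented; free to ℤ-free)

  data FiveTerm : Rel ℤ[F••] (c ⊔ ℓ₂) where
    five-term : (x : Fin 5 → ℙ¹) (distinct : ∀ {i j} → i ≢ j → Distinct (x i) (x j)) →
      FiveTerm
        (altSum ℤ-free λ i → ℤ-gen (cross-ratio (x ∘ punchIn i)
          λ j≢k → distinct (j≢k ∘ punchIn-injective i _ _)))
        (AbelianGroup.ε ℤ-free)

  B₂ : AbelianGroup (c ⊔ ℓ₂) (c ⊔ ℓ₁ ⊔ ℓ₂)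
  B₂ = ℤ-presented FiveTerm

  [_]₂ : F•• → AbelianGroup.Carrier B₂
  [ x ]₂ = ℤ-gen x

  F¹ : LeftModule ring c ℓ₁
  F¹ = TensorUnit.leftModule

  module F⊗F× = Tensor F¹ F×

  open ModulePresentation ring F••-setoid using ()
    renaming (Term to F[F••]; gen to F-gen; presented to F-presented; extend to F-extend; spanned to F-spanned)

  δ : F[F••] → LeftModule.Carrierᴹ F⊗F×.tensor
  δ = F-extend F⊗F×.tensor λ a →
        (val (unit a) ⊗ unit a) +ᴹ (val (one-minus a) ⊗ one-minus a)
    where
    open F⊗F× using (_⊗_)
    open LeftModule F⊗F×.tensor using (_+ᴹ_)

  -- F[F••] modulo ker δ: u and v are identified as soon as δ u = δ v.
  β₂ : LeftModule ring (c ⊔ ℓ₂) (c ⊔ ℓ₁ ⊔ ℓ₂)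
  β₂ = F-presented (LeftModule._≈ᴹ_ F⊗F×.tensor on δ)

  ⟨_⟩₂ : F•• → LeftModule.Carrierᴹ β₂
  ⟨ a ⟩₂ = F-gen a

  open ExteriorSquare F× public using (⋀²; _∧_)
  module F⊗⋀² = Tensor F¹ ⋀²
  module F⊗B₂ = Tensor F¹ B₂

  module WithDerivation (𝒟 : Derivation) where
    open Derivation 𝒟

    βᴰ₂ : LeftModule ring (c ⊔ ℓ₂) (c ⊔ ℓ₁ ⊔ ℓ₂)
    βᴰ₂ = F-spanned β₂ λ a →
      (D (val (unit a)) * val ((unit a ∙ one-minus a) ⁻¹)) *ₗ ⟨ a ⟩₂
      where open LeftModule β₂ using (_*ₗ_)

    ⟦_⟧₂ : F•• → LeftModule.Carrierᴹ βᴰ₂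
    ⟦ a ⟧₂ = F-gen a

    module βᴰ₂⊗F× = Tensor βᴰ₂ F×

    Source : LeftModule ring (c ⊔ ℓ₂) (c ⊔ ℓ₁ ⊔ ℓ₂)
    Source = DirectProduct.leftModule βᴰ₂⊗F×.tensor F⊗B₂.tensor

    Target : LeftModule ring (c ⊔ ℓ₂) (c ⊔ ℓ₁ ⊔ ℓ₂)
    Target = F⊗⋀².tensor

    ∂ᴰ : LeftModule.Carrierᴹ Source → LeftModule.Carrierᴹ Target
    ∂ᴰ (s , t) = ∂β s +ᴹ ∂B t
      where
      open LeftModule Target using (_+ᴹ_; -ᴹ_)
      open F⊗⋀² using (_⊗_)

      ∂β : LeftModule.Carrierᴹ βᴰ₂⊗F×.tensor → LeftModule.Carrierᴹ Target
      ∂β = βᴰ₂⊗F×.extend⊗ Target λ u b →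
        F-extend Target
          (λ a → (Dlog (one-minus a) ⊗ (unit a ∧ b))
                 +ᴹ (-ᴹ (Dlog (unit a) ⊗ (one-minus a ∧ b))))
          u

      ∂B : LeftModule.Carrierᴹ F⊗B₂.tensor → LeftModule.Carrierᴹ Target
      ∂B = F⊗B₂.extend⊗ Target λ x t →
        x ⊗ AbelianPresentation.extend F••-setoid ⋀² (λ y → one-minus y ∧ unit y) t

  ----------------------------------------------------------------------
  -- Vector spaces of dimension 3 with a volume form.

  module VectorSpace {m ℓm : Level} (V : LeftModule ring m ℓm) where
    open LeftModule V
    open LeftModuleMorphisms using (IsLeftModuleHomomorphism; IsLeftModuleIsomorphism)

    lincomb : {n : ℕ} → (Fin n → Carrier) → (Fin n → Carrierᴹ) → Carrierᴹ
    lincomb a v = Sum.sum +ᴹ-commutativeMonoid λ i → a i *ₗ v i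

    record Basis (n : ℕ) : Set (c ⊔ ℓ₁ ⊔ m ⊔ ℓm) where
      field
        e      : Fin n → Carrierᴹ
        coord  : Carrierᴹ → Fin n → Carrier
        expand : ∀ v → lincomb (coord v) e ≈ᴹ v
        unique : ∀ v a → lincomb a e ≈ᴹ v → ∀ i → a i ≈ coord v i

    IsLinearForm : (Carrierᴹ → Carrier) → Set (c ⊔ ℓ₁ ⊔ m ⊔ ℓm)
    IsLinearForm = IsLeftModuleHomomorphism rawLeftModule (LeftModule.rawLeftModule F¹)

    -- A nonzero element of det V₃*, as the alternating trilinear form
    -- (u, v, w) ↦ ⟨ ω , u ∧ v ∧ w ⟩.
    record VolumeForm : Set (c ⊔ ℓ₁ ⊔ ℓ₂ ⊔ m ⊔ ℓm) where
      field
        Δ       : Carrierᴹ → Carrierᴹ → Carrierᴹ → Carrier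
        linear₀ : ∀ v w → IsLinearForm (λ u → Δ u v w)
        linear₁ : ∀ u w → IsLinearForm (λ v → Δ u v w)
        linear₂ : ∀ u v → IsLinearForm (λ w → Δ u v w)
        alt₀₁   : ∀ u w → Δ u u w ≈ 0#
        alt₁₂   : ∀ u v → Δ u v v ≈ 0#
        alt₀₂   : ∀ u v → Δ u v u ≈ 0#
        ω#0     : ∃[ u ] ∃[ v ] ∃[ w ] Δ u v w # 0#

    module _ {n : ℕ} (B : Basis n) where
      open Basis B

      NonZeroVector : Carrierᴹ → Set ℓ₂
      NonZeroVector v = ∃[ i ] coord v i # 0#

      -- Linear independence, stated positively as is appropriate for _#_:
      -- a combination with a nonzero coefficient is nonzero.
      LinearlyIndependent : {k : ℕ} → (Fin k → Carrierᴹ) → Set (c ⊔ ℓ₂)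
      LinearlyIndependent v = ∀ a → ∃[ i ] a i # 0# → NonZeroVector (lincomb a v)

    module Geometry (B : Basis 3) (ω : VolumeForm) where
      open Basis B
      open VolumeForm ω

      --------------------------------------------------------------------
      -- Three linearly independent vectors have Δ # 0, and the Plücker
      -- relation for Δ.

      private
        module VSum = Sum +ᴹ-commutativeMonoid

        coord-cong : ∀ {u v} → u ≈ᴹ v → ∀ i → coord u i ≈ coord v i
        coord-cong {u} {v} u≈v = unique v (coord u) (≈ᴹ-trans (expand u) u≈v)

        coord-0 : ∀ i → coord 0ᴹ i ≈ 0#
        coord-0 i = sym (unique 0ᴹ (λ _ → 0#)
          (≈ᴹ-trans (VSum.sum-cong-≋ {n = 3} (λ j → *ₗ-zeroˡ (e j))) (VSum.sum-replicate-zero 3)) i)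

        coord-+ : ∀ u v i → coord (u +ᴹ v) i ≈ coord u i + coord v i
        coord-+ u v i = sym (unique (u +ᴹ v) (λ j → coord u j + coord v j) lemma i)
          where
          lemma : lincomb (λ j → coord u j + coord v j) e ≈ᴹ u +ᴹ v
          lemma = ≈ᴹ-trans
            (VSum.sum-cong-≋ {n = 3} (λ j → *ₗ-distribʳ (e j) (coord u j) (coord v j)))
            (≈ᴹ-trans
              (VSum.∑-distrib-+ {3} (λ j → coord u j *ₗ e j) (λ j → coord v j *ₗ e j))
              (+ᴹ-cong (expand u) (expand v)))

        *ₗ-lincomb : ∀ {k} x (a : Fin k → Carrier) v → lincomb (λ j → x * a j) v ≈ᴹ x *ₗ lincomb a v
        *ₗ-lincomb {zero}    x a v = ≈ᴹ-sym (*ₗ-zeroʳ x)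
        *ₗ-lincomb {ℕ.suc k} x a v = ≈ᴹ-trans
          (+ᴹ-cong (*ₗ-assoc x (a 0F) (v 0F)) (*ₗ-lincomb x (a ∘ fsuc) (v ∘ fsuc)))
          (≈ᴹ-sym (*ₗ-distribˡ x _ _))

        coord-* : ∀ x v i → coord (x *ₗ v) i ≈ x * coord v i
        coord-* x v i = sym (unique (x *ₗ v) (λ j → x * coord v j)
          (≈ᴹ-trans (*ₗ-lincomb x (coord v) e) (*ₗ-congˡ (expand v))) i)

        coord-lincomb : ∀ a v i → coord (lincomb {3} a v) i ≈
          a 0F * coord (v 0F) i + (a 1F * coord (v 1F) i + a 2F * coord (v 2F) i)
        coord-lincomb a v i =
          trans (coord-+ _ _ i) (+-cong (coord-* _ _ i)
            (trans (coord-+ _ _ i) (+-cong (coord-* _ _ i)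
              (trans (coord-+ _ _ i) (trans (+-cong (coord-* _ _ i) (coord-0 i)) (+-identityʳ _))))))

        Σ³ : (Fin 3 → Carrier) → Carrier
        Σ³ a = a 0F + (a 1F + a 2F)

        Σ³-cong : ∀ {a b} → (∀ i → a i ≈ b i) → Σ³ a ≈ Σ³ b
        Σ³-cong eq = +-cong (eq 0F) (+-cong (eq 1F) (eq 2F))

        -- A linear form is determined by its values on the basis.
        expand-form : ∀ {φ} → IsLinearForm φ → ∀ v → φ v ≈ Σ³ λ i → coord v i * φ (e i)
        expand-form {φ} linear v = begin
          φ v                     ≈⟨ ⟦⟧-cong (expand v) ⟨
          φ (lincomb (coord v) e)
            ≈⟨ trans (+ᴹ-homo _ _) (+-cong (*ₗ-homo _ _)
                 (trans (+ᴹ-homo _ _) (+-cong (*ₗ-homo _ _)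
                   (trans (+ᴹ-homo _ _) (trans (+-cong (*ₗ-homo _ _) 0ᴹ-homo) (+-identityʳ _)))))) ⟩
          Σ³ (λ i → coord v i * φ (e i)) ∎
          where open IsLeftModuleHomomorphism linear

        polarize : (f : Carrierᴹ → Carrierᴹ → Carrier) →
          (∀ v → IsLinearForm (λ u → f u v)) → (∀ u → IsLinearForm (f u)) →
          (∀ u → f u u ≈ 0#) → ∀ u v → f u v + f v u ≈ 0#
        polarize f linearˡ linearʳ alt u v = begin
          f u v + f v u                         ≈⟨ +-identityˡ _ ⟨
          0# + (f u v + f v u)                  ≈⟨ +-identityʳ _ ⟨
          0# + (f u v + f v u) + 0#             ≈⟨ +-cong (+-congʳ (alt u)) (alt v) ⟨
          f u u + (f u v + f v u) + f v v       ≈⟨ solve 4 (λ a b c d → a :+ (b :+ c) :+ d := (a :+ b) :+ (c :+ d)) refl _ _ _ _ ⟩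
          (f u u + f u v) + (f v u + f v v)     ≈⟨ +-cong (ʳ.+ᴹ-homo u u v) (ʳ.+ᴹ-homo v u v) ⟨
          f u (u +ᴹ v) + f v (u +ᴹ v)           ≈⟨ ˡ.+ᴹ-homo (u +ᴹ v) u v ⟨
          f (u +ᴹ v) (u +ᴹ v)                   ≈⟨ alt (u +ᴹ v) ⟩
          0#                                    ∎
          where
          module ˡ v = IsLeftModuleHomomorphism (linearˡ v)
          module ʳ u = IsLeftModuleHomomorphism (linearʳ u)

        swap₀₁ : ∀ u v w → Δ u v w + Δ v u w ≈ 0#
        swap₀₁ u v w = polarize (λ u v → Δ u v w) (λ v → linear₀ v w) (λ u → linear₁ u w) (λ u → alt₀₁ u w) u v

        swap₁₂ : ∀ u v w → Δ u v w + Δ u w v ≈ 0#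
        swap₁₂ u = polarize (Δ u) (λ w → linear₁ u w) (λ v → linear₂ u v) (alt₁₂ u)

        opposite-unique : ∀ {x y z} → x + y ≈ 0# → x + z ≈ 0# → y ≈ z
        opposite-unique {x} {y} {z} x+y≈0 x+z≈0 = begin
          y           ≈⟨ +-identityʳ y ⟨
          y + 0#      ≈⟨ +-congˡ x+z≈0 ⟨
          y + (x + z) ≈⟨ solve 3 (λ x y z → y :+ (x :+ z) := (x :+ y) :+ z) refl x y z ⟩
          (x + y) + z ≈⟨ +-congʳ x+y≈0 ⟩
          0# + z      ≈⟨ +-identityˡ z ⟩
          z           ∎

        T T⁻ : Carrier
        T  = Δ (e 0F) (e 1F) (e 2F)
        T⁻ = Δ (e 0F) (e 2F) (e 1F)

        T+T⁻≈0 : T + T⁻ ≈ 0#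
        T+T⁻≈0 = swap₁₂ _ _ _

        102≈ : Δ (e 1F) (e 0F) (e 2F) ≈ T⁻
        102≈ = opposite-unique (swap₀₁ _ _ _) T+T⁻≈0

        120≈ : Δ (e 1F) (e 2F) (e 0F) ≈ T
        120≈ = opposite-unique (trans (+-congʳ (sym 102≈)) (swap₁₂ _ _ _)) (trans (+-comm _ _) T+T⁻≈0)

        201≈ : Δ (e 2F) (e 0F) (e 1F) ≈ T
        201≈ = opposite-unique (swap₀₁ _ _ _) (trans (+-comm _ _) T+T⁻≈0)

        210≈ : Δ (e 2F) (e 1F) (e 0F) ≈ T⁻
        210≈ = opposite-unique (trans (+-congʳ (sym 201≈)) (swap₁₂ _ _ _)) T+T⁻≈0

        ε : (i j k : Fin 3) → Carrier
        ε 0F 1F 2F = T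
        ε 1F 2F 0F = T
        ε 2F 0F 1F = T
        ε 0F 2F 1F = T⁻
        ε 1F 0F 2F = T⁻
        ε 2F 1F 0F = T⁻
        ε _  _  _  = 0#

        Δ-basis : ∀ i j k → Δ (e i) (e j) (e k) ≈ ε i j k
        Δ-basis 0F 0F 0F = alt₀₁ _ _
        Δ-basis 0F 0F 1F = alt₀₁ _ _
        Δ-basis 0F 0F 2F = alt₀₁ _ _
        Δ-basis 0F 1F 0F = alt₀₂ _ _
        Δ-basis 0F 1F 1F = alt₁₂ _ _
        Δ-basis 0F 1F 2F = refl
        Δ-basis 0F 2F 0F = alt₀₂ _ _
        Δ-basis 0F 2F 1F = refl
        Δ-basis 0F 2F 2F = alt₁₂ _ _
        Δ-basis 1F 0F 0F = alt₁₂ _ _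
        Δ-basis 1F 0F 1F = alt₀₂ _ _
        Δ-basis 1F 0F 2F = 102≈
        Δ-basis 1F 1F 0F = alt₀₁ _ _
        Δ-basis 1F 1F 1F = alt₀₁ _ _
        Δ-basis 1F 1F 2F = alt₀₁ _ _
        Δ-basis 1F 2F 0F = 120≈
        Δ-basis 1F 2F 1F = alt₀₂ _ _
        Δ-basis 1F 2F 2F = alt₁₂ _ _
        Δ-basis 2F 0F 0F = alt₁₂ _ _
        Δ-basis 2F 0F 1F = 201≈
        Δ-basis 2F 0F 2F = alt₀₂ _ _
        Δ-basis 2F 1F 0F = 210≈
        Δ-basis 2F 1F 1F = alt₁₂ _ _
        Δ-basis 2F 1F 2F = alt₀₂ _ _
        Δ-basis 2F 2F 0F = alt₀₁ _ _
        Δ-basis 2F 2F 1F = alt₀₁ _ _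
        Δ-basis 2F 2F 2F = alt₀₁ _ _

        -- The sums of the even and of the odd terms of the determinant.
        even odd : (u v w : Fin 3 → Carrier) → Carrier
        even u v w = u 0F * v 1F * w 2F + u 1F * v 2F * w 0F + u 2F * v 0F * w 1F
        odd  u v w = u 0F * v 2F * w 1F + u 1F * v 0F * w 2F + u 2F * v 1F * w 0F

        Δ≈det : ∀ u v w → Δ u v w ≈ even (coord u) (coord v) (coord w) * T
                                    + odd (coord u) (coord v) (coord w) * T⁻
        Δ≈det u v w = begin
          Δ u v w
            ≈⟨ expand-form (linear₀ v w) u ⟩
          Σ³ (λ i → coord u i * Δ (e i) v w)
            ≈⟨ Σ³-cong (λ i → *-congˡ {coord u i} (expand-form (linear₁ (e i) w) v)) ⟩
          Σ³ (λ i → coord u i * Σ³ λ j → coord v j * Δ (e i) (e j) w)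
            ≈⟨ Σ³-cong (λ i → *-congˡ {coord u i} (Σ³-cong λ j → *-congˡ {coord v j} (expand-form (linear₂ (e i) (e j)) w))) ⟩
          Σ³ (λ i → coord u i * Σ³ λ j → coord v j * Σ³ λ k → coord w k * Δ (e i) (e j) (e k))
            ≈⟨ Σ³-cong (λ i → *-congˡ {coord u i} (Σ³-cong λ j → *-congˡ {coord v j} (Σ³-cong λ k → *-congˡ {coord w k} (Δ-basis i j k)))) ⟩
          Σ³ (λ i → coord u i * Σ³ λ j → coord v j * Σ³ λ k → coord w k * ε i j k)
            ≈⟨ solve 11
                 (λ u₀ u₁ u₂ v₀ v₁ v₂ w₀ w₁ w₂ t t⁻ → let z = S.con 0 in
                   u₀ :* (v₀ :* (w₀ :* z :+ (w₁ :* z :+ w₂ :* z))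
                      :+ (v₁ :* (w₀ :* z :+ (w₁ :* z :+ w₂ :* t))
                      :+  v₂ :* (w₀ :* z :+ (w₁ :* t⁻ :+ w₂ :* z))))
                   :+ (u₁ :* (v₀ :* (w₀ :* z :+ (w₁ :* z :+ w₂ :* t⁻))
                      :+ (v₁ :* (w₀ :* z :+ (w₁ :* z :+ w₂ :* z))
                      :+  v₂ :* (w₀ :* t :+ (w₁ :* z :+ w₂ :* z))))
                   :+  u₂ :* (v₀ :* (w₀ :* z :+ (w₁ :* t :+ w₂ :* z))
                      :+ (v₁ :* (w₀ :* t⁻ :+ (w₁ :* z :+ w₂ :* z))
                      :+  v₂ :* (w₀ :* z :+ (w₁ :* z :+ w₂ :* z)))))
                   := (u₀ :* v₁ :* w₂ :+ u₁ :* v₂ :* w₀ :+ u₂ :* v₀ :* w₁) :* t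
                   :+ (u₀ :* v₂ :* w₁ :+ u₁ :* v₀ :* w₂ :+ u₂ :* v₁ :* w₀) :* t⁻)
                 refl (coord u 0F) (coord u 1F) (coord u 2F)
                      (coord v 0F) (coord v 1F) (coord v 2F)
                      (coord w 0F) (coord w 1F) (coord w 2F) T T⁻ ⟩
          even (coord u) (coord v) (coord w) * T + odd (coord u) (coord v) (coord w) * T⁻ ∎


        opposite#0 : ∀ {x y} → x + y ≈ 0# → x # 0# → y # 0#
        opposite#0 {x} x+y≈0 x#0 = #-congʳ
          (opposite-unique (trans (+-congˡ (+-identityˡ (- x))) (-‿inverseʳ x)) x+y≈0)
          (#⇒-#0 (#-sym x#0))

        T#0 : T # 0#
        T#0 = let (u , v , w , Δ#0) = ω#0 in
          [ factor#0 ∘ #-congʳ (*-comm _ T)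
          , opposite#0 (trans (+-comm T⁻ T) T+T⁻≈0) ∘ factor#0 ∘ #-congʳ (*-comm _ T⁻)
          ]′ (summand#0 (#-congʳ (Δ≈det u v w) Δ#0))

        balance : ∀ {u u′ w w′} → u + w′ ≈ u′ + w → u * T + u′ * T⁻ ≈ w * T + w′ * T⁻
        balance {u} {u′} {w} {w′} eq = opposite-unique {w′ * T + w * T⁻}
          (begin
            (w′ * T + w * T⁻) + (u * T + u′ * T⁻)
              ≈⟨ solve 6 (λ u u′ w w′ t t⁻ → (w′ :* t :+ w :* t⁻) :+ (u :* t :+ u′ :* t⁻)
                                             := (u :+ w′) :* t :+ (u′ :+ w) :* t⁻) refl u u′ w w′ T T⁻ ⟩
            (u + w′) * T + (u′ + w) * T⁻ ≈⟨ +-congˡ (*-congʳ eq) ⟨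
            (u + w′) * T + (u + w′) * T⁻ ≈⟨ vanish _ ⟩
            0#                           ∎)
          (trans (solve 4 (λ w w′ t t⁻ → (w′ :* t :+ w :* t⁻) :+ (w :* t :+ w′ :* t⁻)
                                         := (w :+ w′) :* t :+ (w :+ w′) :* t⁻) refl w w′ T T⁻)
                 (vanish _))
          where
          vanish : ∀ x → x * T + x * T⁻ ≈ 0#
          vanish x = trans (sym (distribˡ x T T⁻)) (trans (*-congˡ T+T⁻≈0) (zeroʳ x))

        -- Coordinate i of Δ(b,c,d) a - Δ(a,c,d) b + Δ(a,b,d) c - Δ(a,b,c) d = 0.
        cramer : ∀ a b c d i → Δ b c d * coord a i + Δ a b d * coord c i
                             ≈ Δ a c d * coord b i + Δ a b c * coord d i
        cramer a b c d i = begin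
          Δ b c d * coord a i + Δ a b d * coord c i
            ≈⟨ +-cong (*-congʳ (Δ≈det b c d)) (*-congʳ (Δ≈det a b d)) ⟩
          (ev b c d * T + od b c d * T⁻) * coord a i + (ev a b d * T + od a b d * T⁻) * coord c i
            ≈⟨ regroup _ _ _ _ _ _ ⟩
          (ev b c d * coord a i + ev a b d * coord c i) * T + (od b c d * coord a i + od a b d * coord c i) * T⁻
            ≈⟨ balance lemma ⟩
          (ev a c d * coord b i + ev a b c * coord d i) * T + (od a c d * coord b i + od a b c * coord d i) * T⁻
            ≈⟨ regroup _ _ _ _ _ _ ⟨
          (ev a c d * T + od a c d * T⁻) * coord b i + (ev a b c * T + od a b c * T⁻) * coord d i
            ≈⟨ +-cong (*-congʳ (Δ≈det a c d)) (*-congʳ (Δ≈det a b c)) ⟨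
          Δ a c d * coord b i + Δ a b c * coord d i ∎
          where
          ev od : (u v w : Carrierᴹ) → Carrier
          ev u v w = even (coord u) (coord v) (coord w)
          od u v w = odd (coord u) (coord v) (coord w)

          regroup : ∀ x x′ y y′ s t → (x * T + x′ * T⁻) * s + (y * T + y′ * T⁻) * t
                                    ≈ (x * s + y * t) * T + (x′ * s + y′ * t) * T⁻
          regroup x x′ y y′ s t = solve 8
            (λ x x′ y y′ s t u u⁻ → (x :* u :+ x′ :* u⁻) :* s :+ (y :* u :+ y′ :* u⁻) :* t
                                    := (x :* s :+ y :* t) :* u :+ (x′ :* s :+ y′ :* t) :* u⁻)
            refl x x′ y y′ s t T T⁻

          -- The minors obtained by deleting row i are minor i u v - minor i v u.
          minor : Fin 3 → (u v : Carrierᴹ) → Carrier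
          minor i u v = coord u ((toℕ i ℕ.+ 1) mod 3) * coord v ((toℕ i ℕ.+ 2) mod 3)

          ev-row : ∀ i u v w → ev u v w ≈ coord u i * minor i v w + coord v i * minor i w u + coord w i * minor i u v
          ev-row 0F u v w = solve 9 (λ u₀ u₁ u₂ v₀ v₁ v₂ w₀ w₁ w₂ →
            u₀ :* v₁ :* w₂ :+ u₁ :* v₂ :* w₀ :+ u₂ :* v₀ :* w₁
            := u₀ :* (v₁ :* w₂) :+ v₀ :* (w₁ :* u₂) :+ w₀ :* (u₁ :* v₂)) refl (coord u 0F) (coord u 1F) (coord u 2F) (coord v 0F) (coord v 1F) (coord v 2F) (coord w 0F) (coord w 1F) (coord w 2F)
          ev-row 1F u v w = solve 9 (λ u₀ u₁ u₂ v₀ v₁ v₂ w₀ w₁ w₂ →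
            u₀ :* v₁ :* w₂ :+ u₁ :* v₂ :* w₀ :+ u₂ :* v₀ :* w₁
            := u₁ :* (v₂ :* w₀) :+ v₁ :* (w₂ :* u₀) :+ w₁ :* (u₂ :* v₀)) refl (coord u 0F) (coord u 1F) (coord u 2F) (coord v 0F) (coord v 1F) (coord v 2F) (coord w 0F) (coord w 1F) (coord w 2F)
          ev-row 2F u v w = solve 9 (λ u₀ u₁ u₂ v₀ v₁ v₂ w₀ w₁ w₂ →
            u₀ :* v₁ :* w₂ :+ u₁ :* v₂ :* w₀ :+ u₂ :* v₀ :* w₁
            := u₂ :* (v₀ :* w₁) :+ v₂ :* (w₀ :* u₁) :+ w₂ :* (u₀ :* v₁)) refl (coord u 0F) (coord u 1F) (coord u 2F) (coord v 0F) (coord v 1F) (coord v 2F) (coord w 0F) (coord w 1F) (coord w 2F)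

          lemma : (ev b c d * coord a i + ev a b d * coord c i) + (od a c d * coord b i + od a b c * coord d i)
                ≈ (od b c d * coord a i + od a b d * coord c i) + (ev a c d * coord b i + ev a b c * coord d i)
          lemma = trans
            (+-cong (+-cong (*-congʳ (ev-row i b c d)) (*-congʳ (ev-row i a b d)))
                    (+-cong (*-congʳ (od-row a c d)) (*-congʳ (od-row a b c))))
            (trans
              (solve 16 (λ a₀ b₀ c₀ d₀ bc cb bd db cd dc ab ba ad da ac ca →
                ((b₀ :* cd :+ c₀ :* db :+ d₀ :* bc) :* a₀ :+ (a₀ :* bd :+ b₀ :* da :+ d₀ :* ab) :* c₀)
                :+ ((a₀ :* dc :+ c₀ :* ad :+ d₀ :* ca) :* b₀ :+ (a₀ :* cb :+ b₀ :* ac :+ c₀ :* ba) :* d₀)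
                := ((b₀ :* dc :+ c₀ :* bd :+ d₀ :* cb) :* a₀ :+ (a₀ :* db :+ b₀ :* ad :+ d₀ :* ba) :* c₀)
                :+ ((a₀ :* cd :+ c₀ :* da :+ d₀ :* ac) :* b₀ :+ (a₀ :* bc :+ b₀ :* ca :+ c₀ :* ab) :* d₀))
                refl (coord a i) (coord b i) (coord c i) (coord d i)
                (minor i b c) (minor i c b) (minor i b d) (minor i d b) (minor i c d) (minor i d c)
                (minor i a b) (minor i b a) (minor i a d) (minor i d a) (minor i a c) (minor i c a))
              (sym (+-cong (+-cong (*-congʳ (od-row b c d)) (*-congʳ (od-row a b d)))
                           (+-cong (*-congʳ (ev-row i a c d)) (*-congʳ (ev-row i a b c))))))
            where
            od-row : ∀ u v w → od u v w ≈ coord u i * minor i w v + coord v i * minor i u w + coord w i * minor i v u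
            od-row u v w = trans
              (solve 9 (λ u₀ u₁ u₂ v₀ v₁ v₂ w₀ w₁ w₂ →
                u₀ :* v₂ :* w₁ :+ u₁ :* v₀ :* w₂ :+ u₂ :* v₁ :* w₀
                := u₀ :* w₁ :* v₂ :+ u₁ :* w₂ :* v₀ :+ u₂ :* w₀ :* v₁) refl
                (coord u 0F) (coord u 1F) (coord u 2F) (coord v 0F) (coord v 1F) (coord v 2F) (coord w 0F) (coord w 1F) (coord w 2F))
              (trans (ev-row i u w v) (solve 3 (λ x y z → x :+ y :+ z := x :+ z :+ y) refl _ _ _))

        cramer-form : ∀ {φ} → IsLinearForm φ → ∀ a b c d →
          Δ b c d * φ a + Δ a b d * φ c ≈ Δ a c d * φ b + Δ a b c * φ d
        cramer-form {φ} linear a b c d = begin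
          Δ b c d * φ a + Δ a b d * φ c
            ≈⟨ +-cong (*-congˡ (expand-form linear a)) (*-congˡ (expand-form linear c)) ⟩
          Δ b c d * Σ³ (λ i → coord a i * φ (e i)) + Δ a b d * Σ³ (λ i → coord c i * φ (e i))
            ≈⟨ collect (Δ b c d) (Δ a b d) (coord a) (coord c) (φ ∘ e) ⟩
          Σ³ (λ i → (Δ b c d * coord a i + Δ a b d * coord c i) * φ (e i))
            ≈⟨ Σ³-cong (λ i → *-congʳ {φ (e i)} (cramer a b c d i)) ⟩
          Σ³ (λ i → (Δ a c d * coord b i + Δ a b c * coord d i) * φ (e i))
            ≈⟨ collect (Δ a c d) (Δ a b c) (coord b) (coord d) (φ ∘ e) ⟨
          Δ a c d * Σ³ (λ i → coord b i * φ (e i)) + Δ a b c * Σ³ (λ i → coord d i * φ (e i))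
            ≈⟨ +-cong (*-congˡ (expand-form linear b)) (*-congˡ (expand-form linear d)) ⟨
          Δ a c d * φ b + Δ a b c * φ d ∎
          where
          collect : ∀ s t x y z → s * Σ³ (λ i → x i * z i) + t * Σ³ (λ i → y i * z i)
                                ≈ Σ³ (λ i → (s * x i + t * y i) * z i)
          collect s t x y z = solve 11
            (λ s t x₀ x₁ x₂ y₀ y₁ y₂ z₀ z₁ z₂ →
               s :* (x₀ :* z₀ :+ (x₁ :* z₁ :+ x₂ :* z₂)) :+ t :* (y₀ :* z₀ :+ (y₁ :* z₁ :+ y₂ :* z₂))
               := (s :* x₀ :+ t :* y₀) :* z₀ :+ ((s :* x₁ :+ t :* y₁) :* z₁ :+ (s :* x₂ :+ t :* y₂) :* z₂))
            refl s t (x 0F) (x 1F) (x 2F) (y 0F) (y 1F) (y 2F) (z 0F) (z 1F) (z 2F)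

      plücker : ∀ a b c d e → Δ a b c * Δ a d e + Δ a b e * Δ a c d ≈ Δ a b d * Δ a c e
      plücker a b c d e = begin
        Δ a b c * Δ a d e + Δ a b e * Δ a c d
          ≈⟨ +-cong (*-comm _ _) (*-comm _ _) ⟩
        Δ a d e * Δ a b c + Δ a c d * Δ a b e
          ≈⟨ cramer-form (linear₂ a b) a c d e ⟨
        Δ c d e * Δ a b a + Δ a c e * Δ a b d
          ≈⟨ +-congʳ (trans (*-congˡ (alt₀₂ a b)) (zeroʳ _)) ⟩
        0# + Δ a c e * Δ a b d
          ≈⟨ +-identityˡ _ ⟩
        Δ a c e * Δ a b d
          ≈⟨ *-comm _ _ ⟩
        Δ a b d * Δ a c e ∎

      independent-proof : (v : Fin 3 → Carrierᴹ) → LinearlyIndependent B v → Δ (v 0F) (v 1F) (v 2F) # 0#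
      independent-proof v independent =
        let i , aᵢ#0          = step₁
            x , y , Δaxy#0    = step₂ i aᵢ#0
            t , Δabt#0        = step₃ x y Δaxy#0
        in  step₄ t Δabt#0
        where
        a = v 0F
        b = v 1F
        c′ = v 2F

        coefficients : (x y z : Carrier) → Fin 3 → Carrier
        coefficients x y z 0F = x
        coefficients x y z 1F = y
        coefficients x y z 2F = z

        combination : ∀ x y z → ∃[ i ] coefficients x y z i # 0# →
          ∃[ i ] x * coord a i + (y * coord b i + z * coord c′ i) # 0#
        combination x y z some#0 = let (i , #0) = independent (coefficients x y z) some#0 in
          i , #-congʳ (coord-lincomb (coefficients x y z) v i) #0

        step₁ : ∃[ i ] coord a i # 0#
        step₁ = let (i , #0) = combination 1# 0# 0# (0F , 1#0) in
          i , #-congʳ (trans (+-cong (*-identityˡ _)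
                          (trans (+-cong (zeroˡ _) (zeroˡ _)) (+-identityˡ 0#))) (+-identityʳ _)) #0

        single : ∀ j k → (Σ³ (λ i → coord a i * ε i j k)) # 0# → ∃[ x ] ∃[ y ] Δ a x y # 0#
        single j k #0 = e j , e k , #-congʳ
          (sym (trans (expand-form (linear₀ (e j) (e k)) a) (Σ³-cong λ i → *-congˡ {coord a i} (Δ-basis i j k)))) #0

        step₂ : ∀ i → coord a i # 0# → ∃[ x ] ∃[ y ] Δ a x y # 0#
        step₂ 0F aᵢ#0 = single 1F 2F (#-congʳ
          (solve 4 (λ x y z t → x :* t := x :* t :+ (y :* S.con 0 :+ z :* S.con 0)) refl
            (coord a 0F) (coord a 1F) (coord a 2F) T) (x#0y#0→xy#0 aᵢ#0 T#0))
        step₂ 1F aᵢ#0 = single 2F 0F (#-congʳ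
          (solve 4 (λ x y z t → y :* t := x :* S.con 0 :+ (y :* t :+ z :* S.con 0)) refl
            (coord a 0F) (coord a 1F) (coord a 2F) T) (x#0y#0→xy#0 aᵢ#0 T#0))
        step₂ 2F aᵢ#0 = single 0F 1F (#-congʳ
          (solve 4 (λ x y z t → z :* t := x :* S.con 0 :+ (y :* S.con 0 :+ z :* t)) refl
            (coord a 0F) (coord a 1F) (coord a 2F) T) (x#0y#0→xy#0 aᵢ#0 T#0))

        -- The combination Δ(b,x,y) a - Δ(a,x,y) b + Δ(a,b,y) x equals Δ(a,b,x) y.
        isolate : ∀ x y i → Δ b x y * coord a i + (- Δ a x y * coord b i + Δ a b y * coord x i)
                          ≈ Δ a b x * coord y i
        isolate x y i = begin
          Δ b x y * coord a i + (- Δ a x y * coord b i + Δ a b y * coord x i)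
            ≈⟨ solve 3 (λ p q r → p :+ (q :+ r) := (p :+ r) :+ q) refl _ _ _ ⟩
          (Δ b x y * coord a i + Δ a b y * coord x i) + - Δ a x y * coord b i
            ≈⟨ +-congʳ (cramer a b x y i) ⟩
          (Δ a x y * coord b i + Δ a b x * coord y i) + - Δ a x y * coord b i
            ≈⟨ solve 4 (λ p q r s → (p :* r :+ s) :+ q :* r := (p :+ q) :* r :+ s) refl _ _ _ _ ⟩
          (Δ a x y - Δ a x y) * coord b i + Δ a b x * coord y i
            ≈⟨ +-congʳ (trans (*-congʳ (-‿inverseʳ _)) (zeroˡ _)) ⟩
          0# + Δ a b x * coord y i
            ≈⟨ +-identityˡ _ ⟩
          Δ a b x * coord y i ∎

        step₃ : ∀ x y → Δ a x y # 0# → ∃[ t ] Δ a b t # 0#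
        step₃ x y Δaxy#0 =
          let (i , #0) = combination (Δ b x y) (- Δ a x y) 0# (1F , opposite#0 (-‿inverseʳ _) Δaxy#0) in
          [ (λ #0′ → x , factor#0 #0′)
          , (λ #0′ → y , opposite#0 (-‿inverseˡ _) (factor#0 #0′))
          ]′ (summand#0 {Δ a b x * coord y i} {(- Δ a b y) * coord x i} (#-congʳ (eq i) #0))
          where
          eq : ∀ i → Δ b x y * coord a i + (- Δ a x y * coord b i + 0# * coord c′ i)
             ≈ Δ a b x * coord y i + - Δ a b y * coord x i
          eq i = begin
            Δ b x y * coord a i + (- Δ a x y * coord b i + 0# * coord c′ i)
              ≈⟨ +-congˡ (+-congˡ (trans (zeroˡ _) (trans (sym (zeroˡ _)) (*-congʳ (sym (-‿inverseʳ (Δ a b y))))))) ⟩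
            Δ b x y * coord a i + (- Δ a x y * coord b i + (Δ a b y - Δ a b y) * coord x i)
              ≈⟨ solve 5 (λ p q r r⁻ s → p :+ (q :+ (r :+ r⁻) :* s) := (p :+ (q :+ r :* s)) :+ r⁻ :* s) refl _ _ _ _ _ ⟩
            (Δ b x y * coord a i + (- Δ a x y * coord b i + Δ a b y * coord x i)) + - Δ a b y * coord x i
              ≈⟨ +-congʳ (isolate x y i) ⟩
            Δ a b x * coord y i + - Δ a b y * coord x i ∎

        step₄ : ∀ t → Δ a b t # 0# → Δ a b c′ # 0#
        step₄ t Δabt#0 = let (i , #0) = combination (Δ b c′ t) (- Δ a c′ t) (Δ a b t) (2F , Δabt#0) in
          factor#0 (#-congʳ (isolate c′ t i) #0)

      abstract
        independent⇒Δ#0 : (v : Fin 3 → Carrierᴹ) → LinearlyIndependent B v → Δ (v 0F) (v 1F) (v 2F) # 0#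
        independent⇒Δ#0 = independent-proof

      --------------------------------------------------------------------
      -- Configurations of n vectors in generic position.

      record Configuration (n : ℕ) : Set (c ⊔ ℓ₂ ⊔ m) where
        constructor configuration
        field
          vector  : Fin n → Carrierᴹ
          generic : ∀ {k} → k ≤ 3 → (σ : Fin k → Fin n) → Injective _≡_ _≡_ σ →
                    LinearlyIndependent B (vector ∘ σ)
      open Configuration

      Configuration-setoid : ℕ → Setoid (c ⊔ ℓ₂ ⊔ m) ℓm
      Configuration-setoid n = record
        { Carrier = Configuration n
        ; _≈_ = λ l l′ → ∀ i → vector l i ≈ᴹ vector l′ i
        ; isEquivalence = record
          { refl = λ _ → ≈ᴹ-refl
          ; sym = λ l≈l′ i → ≈ᴹ-sym (l≈l′ i)
          ; trans = λ l≈l′ l′≈l″ i → ≈ᴹ-trans (l≈l′ i) (l′≈l″ i)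
          }
        }

      module ℤ[Configuration] (n : ℕ) = AbelianPresentation (Configuration-setoid n)

      data GLAction (n : ℕ) : Rel (ℤ[Configuration].Term n) (c ⊔ ℓ₁ ⊔ ℓ₂ ⊔ m ⊔ ℓm) where
        act : (g : Carrierᴹ → Carrierᴹ) → IsLeftModuleIsomorphism rawLeftModule rawLeftModule g →
              (l l′ : Configuration n) → (∀ i → vector l′ i ≈ᴹ g (vector l i)) →
              GLAction n (ℤ[Configuration].gen l′) (ℤ[Configuration].gen l)

      -- Cₙ(3)
      C : ℕ → AbelianGroup (c ⊔ ℓ₂ ⊔ m) (c ⊔ ℓ₁ ⊔ ℓ₂ ⊔ m ⊔ ℓm)
      C n = ℤ[Configuration].presented n (GLAction n)

      reindex : ∀ {n k} → Configuration n → (σ : Fin k → Fin n) → Injective _≡_ _≡_ σ → Configuration k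
      reindex l σ σ-injective = configuration (vector l ∘ σ)
        λ k≤3 ρ ρ-injective → generic l k≤3 (σ ∘ ρ) (ρ-injective ∘ σ-injective)

      -- (l₀, …, l̂ᵢ, …, lₙ)
      delete : ∀ {n} → Fin (ℕ.suc n) → Configuration (ℕ.suc n) → Configuration n
      delete i l = reindex l (punchIn i) (punchIn-injective i _ _)

      -- (lᵢ, l₀, …, l̂ᵢ, …, lₙ)
      move-to-front : ∀ {n} → Fin (ℕ.suc n) → Configuration (ℕ.suc n) → Configuration (ℕ.suc n)
      move-to-front {n} i l = reindex l front front-injective
        where
        front : Fin (ℕ.suc n) → Fin (ℕ.suc n)
        front 0F       = i
        front (fsuc j) = punchIn i j

        front-injective : Injective _≡_ _≡_ front
        front-injective {0F}     {0F}     _  = ≡.refl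
        front-injective {0F}     {fsuc k} eq = contradiction (≡.sym eq) (punchInᵢ≢i i k)
        front-injective {fsuc j} {0F}     eq = contradiction eq (punchInᵢ≢i i j)
        front-injective {fsuc j} {fsuc k} eq = ≡.cong fsuc (punchIn-injective i j k eq)

      Δ× : ∀ {n} → Configuration n → (i j k : Fin n)
           {i≢j : False (i ≟ j)} {i≢k : False (i ≟ k)} {j≢k : False (j ≟ k)} → NonZero
      Δ× {n} l i j k {i≢j} {i≢k} {j≢k} = nonZero (Δ (vector l i) (vector l j) (vector l k))
        (independent⇒Δ#0 (vector l ∘ σ) (generic l ≤-refl σ σ-injective))
        where
        σ : Fin 3 → Fin n
        σ 0F = i
        σ 1F = j
        σ 2F = k

        σ-injective : Injective _≡_ _≡_ σ
        σ-injective {0F} {0F} _  = ≡.refl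
        σ-injective {0F} {1F} eq = contradiction eq (toWitnessFalse i≢j)
        σ-injective {0F} {2F} eq = contradiction eq (toWitnessFalse i≢k)
        σ-injective {1F} {0F} eq = contradiction (≡.sym eq) (toWitnessFalse i≢j)
        σ-injective {1F} {1F} _  = ≡.refl
        σ-injective {1F} {2F} eq = contradiction eq (toWitnessFalse j≢k)
        σ-injective {2F} {0F} eq = contradiction (≡.sym eq) (toWitnessFalse i≢k)
        σ-injective {2F} {1F} eq = contradiction (≡.sym eq) (toWitnessFalse j≢k)
        σ-injective {2F} {2F} _  = ≡.refl

      -- Δ(l₀, …, l̂ᵢ, …, l₃)
      Δ̂ : Configuration 4 → Fin 4 → NonZero
      Δ̂ l i = Δ× (delete i l) 0F 1F 2F

      -- ∏_{j ≠ i} Δ(l̂ᵢ, l̂ⱼ): after deleting lᵢ, the indices j ≠ i are those of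
      -- the four remaining vectors.
      ∏Δ̂ : Configuration 5 → Fin 5 → NonZero
      ∏Δ̂ l i = Sum.sum (AbelianGroup.commutativeMonoid F×) (Δ̂ (delete i l))

      -- r(l₀|l₁,l₂,l₃,l₄) = Δ(l₀,l₁,l₄) Δ(l₀,l₂,l₃) / Δ(l₀,l₁,l₃) Δ(l₀,l₂,l₄)
      projected-cross-ratio : Configuration 5 → F••
      projected-cross-ratio l = ratio
        (Δ× l 0F 1F 4F ∙ Δ× l 0F 2F 3F)
        (Δ× l 0F 1F 3F ∙ Δ× l 0F 2F 4F)
        (Δ× l 0F 1F 2F ∙ Δ× l 0F 3F 4F)
        (plücker (vector l 0F) (vector l 1F) (vector l 2F) (vector l 3F) (vector l 4F))

      -- r(lᵢ|l₀, …, l̂ᵢ, …, l₄)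
      r̂ : Configuration 5 → Fin 5 → F••
      r̂ l i = projected-cross-ratio (move-to-front i l)

      d : ∀ {n} → AbelianGroup.Carrier (C (ℕ.suc n)) → AbelianGroup.Carrier (C n)
      d {n} = ℤ[Configuration].extend (ℕ.suc n) (C n)
        λ l → altSum (C n) λ i → ℤ[Configuration].gen (delete i l)

      module Maps (𝒟 : Derivation) where
        open Derivation 𝒟
        open WithDerivation 𝒟

        τ₀ : AbelianGroup.Carrier (C 4) → LeftModule.Carrierᴹ Target
        τ₀ = ℤ[Configuration].extend 4 target λ l → altSum target λ i →
          Dlog (Δ̂ l i) ⊗ ( (Δ̂ l (i ⊕ 1) / Δ̂ l (i ⊕ 2))
                         ∧ (Δ̂ l (i ⊕ 3) / Δ̂ l (i ⊕ 2)))
          where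
          open F⊗⋀² using (_⊗_)
          target = LeftModule.+ᴹ-abelianGroup Target
          _⊕_ : Fin 4 → ℕ → Fin 4
          i ⊕ n = (toℕ i ℕ.+ n) mod 4

        τ₁ : 1# + 1# + 1# # 0# → AbelianGroup.Carrier (C 5) → LeftModule.Carrierᴹ Source
        τ₁ 3#0 = ℤ[Configuration].extend 5 source λ l → (- val (three ⁻¹)) · altSum source λ i →
            ( ⟦ r̂ l i ⟧₂ βᴰ₂⊗F×.⊗ ∏Δ̂ l i
            , Dlog (∏Δ̂ l i) F⊗B₂.⊗ [ r̂ l i ]₂ )
          where
          open LeftModule Source using () renaming (_*ₗ_ to _·_)
          source = LeftModule.+ᴹ-abelianGroup Source
          three : NonZero
          three = nonZero (1# + 1# + 1#) 3#0

{-# OPTIONS --safe #-}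

-- Write {a, b, c} for Dlog a ⊗ b ∧ c + Dlog b ⊗ c ∧ a + Dlog c ⊗ a ∧ b, an alternating
-- trilinear function on F×.  If Δᵢⱼ is the minor of (l₀, …, l₄) omitting lᵢ and lⱼ, then
-- τ₀ ∘ d is a signed sum of the {Δᵢⱼ, Δᵢₖ, Δᵢₘ}, one for each i and each triple of other
-- indices, and -3 ∂ᴰ ∘ τ₁ is the signed sum over i of the {1 - rᵢ, rᵢ, ∏ⱼ Δᵢⱼ}.  By the
-- Plücker relation 1 - rᵢ is, like rᵢ, a quotient of products of minors, so both sides
-- are integer combinations of elements {Δ, Δ′, Δ″}.  View Δᵢⱼ as the edge ij of the
-- complete graph K₅.  The triples of edges on the second side form a path of length
-- three, a path of length two with a disjoint edge, or a star; those of the first two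
-- kinds cancel in pairs, and each star occurs three times.
--
-- The coefficients are compared by evaluation, after expanding everything in the
-- elements Dlog Δ ⊗ Δ′ ∧ Δ″.  Reordering the columns of a minor changes its sign, and -1
-- is torsion in F×: this is where equality modulo 2-torsion is needed.

module Submission where

open import Level using (Level; _⊔_)
open import Algebra.Apartness.Bundles using (HeytingField)
open import Algebra.Bundles using (AbelianGroup)
open import Algebra.Module.Bundles using (LeftModule)
open import Algebra.Module.Morphism.Structures using (module LeftModuleMorphisms)
open import Data.Fin.Base using (Fin; toℕ; _↑ˡ_) renaming (zero to fzero; suc to fsuc)
open import Data.Fin.Patterns
open import Data.Fin.Properties using (all?)
open import Data.Integer.Base as ℤ using (ℤ; +_; -[1+_])
import Data.Integer.Properties as ℤ
open import Data.Nat.Base as ℕ using (ℕ; zero; suc)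
open import Data.Nat.DivMod using (_mod_)
import Data.Nat.Properties as ℕ
open import Data.Product.Base using (_,_)
open import Data.Sum.Base using (_⊎_; inj₁; inj₂; [_,_]′)
open import Data.Vec.Base using (Vec; []; _∷_; lookup)
open import Function.Base using (_∘_)
open import Relation.Binary.Core using (REL)
open import Relation.Binary.PropositionalEquality.Core as ≡ using (_≡_)
open import Relation.Nullary.Decidable using (from-yes)
import Algebra.Construct.Pointwise as Pointwise
import Algebra.Properties.AbelianGroup as AbelianGroupProperties
import Algebra.Properties.CommutativeMonoid.Mult as Mult
import Algebra.Properties.CommutativeMonoid.Sum as Sum
import Algebra.Properties.CommutativeSemigroup as CommutativeSemigroupProperties
import Algebra.Properties.Ring as RingProperties
import Relation.Binary.Reasoning.Setoid as SetoidReasoning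
open import Defs

private
  variable
    a ℓa b ℓb g ℓg ℓ ℓ′ : Level
    n : ℕ

-- Additive maps and relations compatible with the group operations

record IsAdditive (A : AbelianGroup a ℓa) (G : AbelianGroup g ℓg)
                  (φ : AbelianGroup.Carrier A → AbelianGroup.Carrier G) : Set (a ⊔ ℓa ⊔ ℓg) where
  private
    module A = AbelianGroup A
    module G = AbelianGroup G
    module GP = AbelianGroupProperties G
  field
    cong   : ∀ {x y} → x A.≈ y → φ x G.≈ φ y
    ∙-homo : ∀ x y → φ (x A.∙ y) G.≈ φ x G.∙ φ y

  ε-homo : φ A.ε G.≈ G.ε
  ε-homo = GP.identityˡ-unique _ _ (G.trans (G.sym (∙-homo A.ε A.ε)) (cong (A.identityˡ A.ε)))

  ⁻¹-homo : ∀ x → φ (x A.⁻¹) G.≈ φ x G.⁻¹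
  ⁻¹-homo x = GP.inverseˡ-unique _ _
    (G.trans (G.sym (∙-homo _ _)) (G.trans (cong (A.inverseˡ x)) ε-homo))

compose : {A : AbelianGroup a ℓa} {B : AbelianGroup b ℓb} {G : AbelianGroup g ℓg} {φ : _} {ψ : _} →
          IsAdditive A B φ → IsAdditive B G ψ → IsAdditive A G (ψ ∘ φ)
compose {G = G} φ-additive ψ-additive = record
  { cong = ψ.cong ∘ φ.cong
  ; ∙-homo = λ x y → AbelianGroup.trans G (ψ.cong (φ.∙-homo x y)) (ψ.∙-homo _ _)
  }
  where
  module φ = IsAdditive φ-additive
  module ψ = IsAdditive ψ-additive

-- Logical relations between groups: any expression built from the group operations takes related
-- values on related inputs. With `_≈_` this yields congruence, with the graph of a map φ it yields
-- compatibility with φ, so sums and signs are treated only once.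
record IsGroupRelation (A : AbelianGroup a ℓa) (B : AbelianGroup b ℓb)
                       (_~_ : REL (AbelianGroup.Carrier A) (AbelianGroup.Carrier B) ℓ)
                       : Set (a ⊔ b ⊔ ℓ) where
  private
    module A = AbelianGroup A
    module B = AbelianGroup B
  field
    ∙-rel  : ∀ {x y u v} → x ~ u → y ~ v → (x A.∙ y) ~ (u B.∙ v)
    ε-rel  : A.ε ~ B.ε
    ⁻¹-rel : ∀ {x u} → x ~ u → (x A.⁻¹) ~ (u B.⁻¹)

  sum-rel : {f : Fin n → A.Carrier} {h : Fin n → B.Carrier} → (∀ i → f i ~ h i) →
            Sum.sum A.commutativeMonoid f ~ Sum.sum B.commutativeMonoid h
  sum-rel {n = zero}  r = ε-rel
  sum-rel {n = suc n} r = ∙-rel (r fzero) (sum-rel (r ∘ fsuc))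

  sign-rel : ∀ k {x u} → x ~ u → sign A k x ~ sign B k u
  sign-rel zero    r = r
  sign-rel (suc k) r = ⁻¹-rel (sign-rel k r)

  altSum-rel : {f : Fin n → A.Carrier} {h : Fin n → B.Carrier} → (∀ i → f i ~ h i) →
               altSum A f ~ altSum B h
  altSum-rel r = sum-rel (λ i → sign-rel (toℕ i) (r i))

≈-rel : (G : AbelianGroup g ℓg) → IsGroupRelation G G (AbelianGroup._≈_ G)
≈-rel G = record { ∙-rel = ∙-cong ; ε-rel = refl ; ⁻¹-rel = ⁻¹-cong }
  where open AbelianGroup G

-- Equality modulo 2-torsion

module Mod2Torsion (G : AbelianGroup g ℓg) where
  open AbelianGroup G
  open AbelianGroupProperties G
  open CommutativeSemigroupProperties commutativeSemigroup using (interchange)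
  open SetoidReasoning setoid

  infix 4 _≈₂_
  _≈₂_ = EqualMod2Torsion G

  square-∙ : ∀ {x y} → x ∙ x ≈ ε → y ∙ y ≈ ε → (x ∙ y) ∙ (x ∙ y) ≈ ε
  square-∙ x²≈ε y²≈ε = trans (interchange _ _ _ _) (trans (∙-cong x²≈ε y²≈ε) (identityˡ ε))

  square-⁻¹ : ∀ {x} → x ∙ x ≈ ε → x ⁻¹ ∙ x ⁻¹ ≈ ε
  square-⁻¹ x²≈ε = trans (⁻¹-∙-comm _ _) (trans (⁻¹-cong x²≈ε) ε⁻¹≈ε)

  square-cong : ∀ {x y} → x ≈ y → x ∙ x ≈ ε → y ∙ y ≈ ε
  square-cong x≈y = trans (sym (∙-cong x≈y x≈y))

  ≈⇒≈₂ : ∀ {x y} → x ≈ y → x ≈₂ y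
  ≈⇒≈₂ x≈y = square-cong (sym (x≈y⇒x∙y⁻¹≈ε x≈y)) (identityˡ ε)

  ∙-difference : ∀ x y u v → (x - u) ∙ (y - v) ≈ (x ∙ y) - (u ∙ v)
  ∙-difference x y u v = trans (interchange _ _ _ _) (∙-congˡ (⁻¹-∙-comm u v))

  -- The quotient by the 2-torsion subgroup. Only the equality is coarsened; carrier and operations
  -- are unchanged, so an expression in G can be read in the quotient without translation.
  modulo₂ : AbelianGroup _ _
  modulo₂ = record
    { Carrier = Carrier
    ; _≈_ = _≈₂_
    ; _∙_ = _∙_
    ; ε = ε
    ; _⁻¹ = _⁻¹
    ; isAbelianGroup = record
      { isGroup = record
        { isMonoid = record
          { isSemigroup = record
            { isMagma = record
              { isEquivalence = record
                { refl = ≈⇒≈₂ refl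
                ; sym = λ x≈₂y → square-cong (⁻¹-anti-homo‿- _ _) (square-⁻¹ x≈₂y)
                ; trans = λ x≈₂y y≈₂z → square-cong (telescope _ _ _) (square-∙ x≈₂y y≈₂z)
                }
              ; ∙-cong = λ x≈₂u y≈₂v → square-cong (∙-difference _ _ _ _) (square-∙ x≈₂u y≈₂v)
              }
            ; assoc = λ x y z → ≈⇒≈₂ (assoc x y z)
            }
          ; identity = (λ x → ≈⇒≈₂ (identityˡ x)) , λ x → ≈⇒≈₂ (identityʳ x)
          }
        ; inverse = (λ x → ≈⇒≈₂ (inverseˡ x)) , λ x → ≈⇒≈₂ (inverseʳ x)
        ; ⁻¹-cong = λ x≈₂y → square-cong (sym (⁻¹-∙-comm _ _)) (square-⁻¹ x≈₂y)
        }
      ; comm = λ x y → ≈⇒≈₂ (comm x y)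
      }
    }
    where
    telescope : ∀ x y z → (x - y) ∙ (y - z) ≈ x - z
    telescope x y z = begin
      (x - y) ∙ (y - z)     ≈⟨ assoc _ _ _ ⟩
      x ∙ (y ⁻¹ ∙ (y - z))  ≈⟨ ∙-congˡ (assoc _ _ _) ⟨
      x ∙ (y ⁻¹ ∙ y - z)    ≈⟨ ∙-congˡ (∙-congʳ (inverseˡ y)) ⟩
      x ∙ (ε - z)           ≈⟨ ∙-congˡ (identityˡ _) ⟩
      x - z                 ∎

  equal-squares⇒≈₂ : ∀ {x y} → x ∙ x ≈ y ∙ y → x ≈₂ y
  equal-squares⇒≈₂ x²≈y² = trans (∙-difference _ _ _ _) (x≈y⇒x∙y⁻¹≈ε x²≈y²)

  square-ε⇒≈₂ε : ∀ {x} → x ∙ x ≈ ε → x ≈₂ ε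
  square-ε⇒≈₂ε x²≈ε = equal-squares⇒≈₂ (trans x²≈ε (sym (identityˡ ε)))

open Mod2Torsion using (modulo₂; ≈⇒≈₂; square-ε⇒≈₂ε; equal-squares⇒≈₂)

into-modulo₂ : {A : AbelianGroup a ℓa} {G : AbelianGroup g ℓg} {φ : _} → IsAdditive A G φ → IsAdditive A (modulo₂ G) φ
into-modulo₂ {G = G} additive = record
  { cong = λ x≈y → ≈⇒≈₂ G (cong x≈y)
  ; ∙-homo = λ x y → ≈⇒≈₂ G (∙-homo x y)
  }
  where open IsAdditive additive

-- An additive map sends 2-torsion to 2-torsion, hence descends to the quotients.
modulo₂-additive : {A : AbelianGroup a ℓa} {G : AbelianGroup g ℓg} {φ : _} →
                   IsAdditive A G φ → IsAdditive (modulo₂ A) (modulo₂ G) φ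
modulo₂-additive {A = A} {G} {φ} additive = record
  { cong = λ {x} {y} x≈₂y → begin
      (φ x G.- φ y) G.∙ (φ x G.- φ y)   ≈⟨ G.∙-cong (difference x y) (difference x y) ⟨
      φ (x A.- y) G.∙ φ (x A.- y)       ≈⟨ ∙-homo _ _ ⟨
      φ ((x A.- y) A.∙ (x A.- y))       ≈⟨ cong x≈₂y ⟩
      φ A.ε                             ≈⟨ ε-homo ⟩
      G.ε                               ∎
  ; ∙-homo = λ x y → ≈⇒≈₂ G (∙-homo x y)
  }
  where
  module A = AbelianGroup A
  module G = AbelianGroup G
  open IsAdditive additive
  open SetoidReasoning G.setoid
  difference : ∀ x y → φ (x A.- y) G.≈ φ x G.- φ y
  difference x y = G.trans (∙-homo _ _) (G.∙-congˡ (⁻¹-homo y))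

-- Combinations with integer coefficients

module IntegerMultiples (G : AbelianGroup g ℓg) where
  open AbelianGroup G
  open AbelianGroupProperties G
  open Mult commutativeMonoid using (_×_; ×-homo-+; ×-distrib-+; ×-congʳ)
  open CommutativeSemigroupProperties commutativeSemigroup using (interchange)
  open SetoidReasoning setoid

  infixr 8 _·_
  _·_ : ℤ → Carrier → Carrier
  (+ n)    · x = n × x
  -[1+ n ] · x = (suc n × x) ⁻¹

  ⊖-· : ∀ m n x → (m ℤ.⊖ n) · x ≈ (m × x) - (n × x)
  ⊖-· zero    zero    x = sym (inverseʳ ε)
  ⊖-· zero    (suc n) x = sym (identityˡ _)
  ⊖-· (suc m) zero    x = sym (trans (∙-congˡ ε⁻¹≈ε) (identityʳ _))
  ⊖-· (suc m) (suc n) x = begin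
    (suc m ℤ.⊖ suc n) · x               ≡⟨ ≡.cong (_· x) (ℤ.[1+m]⊖[1+n]≡m⊖n m n) ⟩
    (m ℤ.⊖ n) · x                       ≈⟨ ⊖-· m n x ⟩
    (m × x) - (n × x)                   ≈⟨ identityˡ _ ⟨
    -- Writing ε as x - x supplies the extra copy of x in each of the two multiples.
    ε ∙ ((m × x) - (n × x))             ≈⟨ ∙-congʳ (inverseʳ x) ⟨
    (x - x) ∙ ((m × x) - (n × x))       ≈⟨ interchange _ _ _ _ ⟩
    (suc m × x) ∙ (x ⁻¹ ∙ (n × x) ⁻¹)   ≈⟨ ∙-congˡ (⁻¹-∙-comm _ _) ⟩
    (suc m × x) - (suc n × x)           ∎

  +-· : ∀ i j x → (i ℤ.+ j) · x ≈ i · x ∙ j · x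
  +-· (+ m)    (+ n)    x = ×-homo-+ x m n
  +-· (+ m)    -[1+ n ] x = ⊖-· m (suc n) x
  +-· -[1+ m ] (+ n)    x = trans (⊖-· n (suc m) x) (comm _ _)
  +-· -[1+ m ] -[1+ n ] x = trans
    (⁻¹-cong (trans (reflexive (≡.cong (λ k → suc k × x) (≡.sym (ℕ.+-suc m n)))) (×-homo-+ x (suc m) (suc n))))
    (sym (⁻¹-∙-comm _ _))

  ·-additiveˡ : ∀ x → IsAdditive ℤ.+-0-abelianGroup G (_· x)
  ·-additiveˡ x = record { cong = λ i≡j → reflexive (≡.cong (_· x) i≡j) ; ∙-homo = λ i j → +-· i j x }

  ·-additiveʳ : ∀ i → IsAdditive G G (i ·_)
  ·-additiveʳ (+ n)    = record { cong = ×-congʳ n ; ∙-homo = λ x y → ×-distrib-+ x y n }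
  ·-additiveʳ -[1+ n ] = record
    { cong = λ x≈y → ⁻¹-cong (×-congʳ (suc n) x≈y)
    ; ∙-homo = λ x y → trans (⁻¹-cong (×-distrib-+ x y (suc n))) (sym (⁻¹-∙-comm _ _))
    }

  *-· : ∀ i j x → (i ℤ.* j) · x ≈ i · j · x
  *-· (+ n)    j x = nonNegative n
    where
    nonNegative : ∀ n → (+ n ℤ.* j) · x ≈ n × (j · x)
    nonNegative zero    = refl
    nonNegative (suc n) = begin
      (+ suc n ℤ.* j) · x          ≡⟨ ≡.cong (_· x) (ℤ.suc-* (+ n) j) ⟩
      (j ℤ.+ + n ℤ.* j) · x        ≈⟨ +-· j _ x ⟩
      j · x ∙ (+ n ℤ.* j) · x      ≈⟨ ∙-congˡ (nonNegative n) ⟩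
      j · x ∙ (n × (j · x))        ∎
  *-· -[1+ n ] j x = begin
    (-[1+ n ] ℤ.* j) · x           ≡⟨ ≡.cong (_· x) (ℤ.neg-distribˡ-* (+ suc n) j) ⟨
    (ℤ.- (+ suc n ℤ.* j)) · x      ≈⟨ IsAdditive.⁻¹-homo (·-additiveˡ x) (+ suc n ℤ.* j) ⟩
    ((+ suc n ℤ.* j) · x) ⁻¹       ≈⟨ ⁻¹-cong (*-· (+ suc n) j x) ⟩
    -[1+ n ] · j · x               ∎

-- No congruence is asked of φ, so this also applies to maps defined on formal expressions by
-- recursion, such as `τ₀` and `∂ᴰ`.
record Graph (G : AbelianGroup g ℓg) {B : Set b} (φ : B → AbelianGroup.Carrier G)
             (x : AbelianGroup.Carrier G) (u : B) : Set ℓg where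
  constructor graph
  field
    image : AbelianGroup._≈_ G x (φ u)

module _ {A : AbelianGroup a ℓa} {G : AbelianGroup g ℓg} {φ : _} (additive : IsAdditive A G φ) where
  private
    module A where
      open AbelianGroup A public
      open IntegerMultiples A public
      open Sum commutativeMonoid public
    module G where
      open AbelianGroup G public
      open IntegerMultiples G public
      open Sum commutativeMonoid public
  open IsAdditive additive

  graph-rel : IsGroupRelation G A (Graph G φ)
  graph-rel = record
    { ∙-rel = λ (graph p) (graph q) → graph (G.trans (G.∙-cong p q) (G.sym (∙-homo _ _)))
    ; ε-rel = graph (G.sym ε-homo)
    ; ⁻¹-rel = λ (graph p) → graph (G.trans (G.⁻¹-cong p) (G.sym (⁻¹-homo _)))
    }

  sum-homo : (f : Fin n → A.Carrier) → φ (A.sum f) G.≈ G.sum (φ ∘ f)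
  sum-homo f = G.sym (Graph.image (IsGroupRelation.sum-rel graph-rel {h = f} λ _ → graph G.refl))

  ·-homo : ∀ i x → φ (i A.· x) G.≈ i G.· φ x
  ·-homo (+ n)    x = nonNegative n
    where
    nonNegative : ∀ n → φ ((+ n) A.· x) G.≈ (+ n) G.· φ x
    nonNegative zero    = ε-homo
    nonNegative (suc n) = G.trans (∙-homo _ _) (G.∙-congˡ (nonNegative n))
  ·-homo -[1+ n ] x = G.trans (⁻¹-homo _) (G.⁻¹-cong (·-homo (+ suc n) x))

ℤ^_ : ℕ → AbelianGroup _ _
ℤ^ n = Pointwise.abelianGroup (Fin n) ℤ.+-0-abelianGroup

δᵢ : Fin n → Fin n → ℤ
δᵢ fzero    fzero    = + 1
δᵢ fzero    (fsuc j) = + 0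
δᵢ (fsuc i) fzero    = + 0
δᵢ (fsuc i) (fsuc j) = δᵢ i j

module IntegerCombinations (G : AbelianGroup g ℓg) where
  open AbelianGroup G
  open IntegerMultiples G public
  open Sum commutativeMonoid

  combine : (Fin n → ℤ) → (Fin n → Carrier) → Carrier
  combine α x = sum λ i → α i · x i

  combine-additive : (x : Fin n → Carrier) → IsAdditive (ℤ^ n) G (λ α → combine α x)
  combine-additive x = record
    { cong = λ α≡β → sum-cong-≋ λ i → IsAdditive.cong (·-additiveˡ (x i)) (α≡β i)
    ; ∙-homo = λ α β → trans (sum-cong-≋ λ i → +-· (α i) (β i) (x i)) (∑-distrib-+ (λ i → α i · x i) (λ i → β i · x i))
    }

  combine-cong : (α : Fin n → ℤ) {x y : Fin n → Carrier} → (∀ i → x i ≈ y i) → combine α x ≈ combine α y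
  combine-cong α x≈y = sum-cong-≋ λ i → IsAdditive.cong (·-additiveʳ (α i)) (x≈y i)

  combine-* : ∀ i (α : Fin n → ℤ) x → combine (λ j → i ℤ.* α j) x ≈ i · combine α x
  combine-* i α x = trans (sum-cong-≋ λ j → *-· i (α j) (x j)) (sym (sum-homo (·-additiveʳ i) (λ j → α j · x j)))

  combine-δ : (i : Fin n) (x : Fin n → Carrier) → combine (δᵢ i) x ≈ x i
  combine-δ {suc n} fzero    x = trans (∙-cong (identityʳ _) (sum-replicate-zero n)) (identityʳ _)
  combine-δ {suc n} (fsuc i) x = trans (identityˡ _) (combine-δ i (x ∘ fsuc))

module _ {A : AbelianGroup a ℓa} {G : AbelianGroup g ℓg} {φ : _} (additive : IsAdditive A G φ) where
  private
    module A = IntegerCombinations A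
    module G = IntegerCombinations G

  combine-homo : (α : Fin n → ℤ) (x : Fin n → AbelianGroup.Carrier A) →
                 AbelianGroup._≈_ G (φ (A.combine α x)) (G.combine α (φ ∘ x))
  combine-homo α x = AbelianGroup.trans G (sum-homo additive (λ i → α i A.· x i))
    (Sum.sum-cong-≋ (AbelianGroup.commutativeMonoid G) λ i → ·-homo additive (α i) (x i))

-- Trilinear maps and the tensor cube of ℤⁿ, as arrays of coefficients

ℤ^_³ : ℕ → AbelianGroup _ _
ℤ^ n ³ = Pointwise.abelianGroup (Fin n) (Pointwise.abelianGroup (Fin n) (ℤ^ n))

module TripleCombinations (G : AbelianGroup g ℓg) where
  open AbelianGroup G
  open IntegerCombinations G
  open Sum commutativeMonoid
  open SetoidReasoning setoid

  sum³ : (Fin n → Fin n → Fin n → Carrier) → Carrier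
  sum³ f = sum λ i → sum λ j → sum λ k → f i j k

  sum³-cong : {f h : Fin n → Fin n → Fin n → Carrier} → (∀ i j k → f i j k ≈ h i j k) → sum³ f ≈ sum³ h
  sum³-cong eq = sum-cong-≋ λ i → sum-cong-≋ λ j → sum-cong-≋ λ k → eq i j k

  sum³-∙ : (f h : Fin n → Fin n → Fin n → Carrier) → sum³ (λ i j k → f i j k ∙ h i j k) ≈ sum³ f ∙ sum³ h
  sum³-∙ f h = trans
    (sum-cong-≋ λ i → trans
      (sum-cong-≋ λ j → ∑-distrib-+ (f i j) (h i j))
      (∑-distrib-+ (λ j → sum (f i j)) (λ j → sum (h i j))))
    (∑-distrib-+ (λ i → sum λ j → sum (f i j)) (λ i → sum λ j → sum (h i j)))

  combine³ : (Fin n → Fin n → Fin n → ℤ) → (Fin n → Fin n → Fin n → Carrier) → Carrier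
  combine³ U z = sum³ λ i j k → U i j k · z i j k

  combine³-additive : (z : Fin n → Fin n → Fin n → Carrier) → IsAdditive (ℤ^ n ³) G (λ U → combine³ U z)
  combine³-additive z = record
    { cong = λ U≡V → sum³-cong λ i j k → IsAdditive.cong (·-additiveˡ (z i j k)) (U≡V i j k)
    ; ∙-homo = λ U V → trans (sum³-cong λ i j k → +-· (U i j k) (V i j k) (z i j k))
                             (sum³-∙ (λ i j k → U i j k · z i j k) (λ i j k → V i j k · z i j k))
    }

  -- Exchanging the summations over j and k in one of the two copies pairs U i j k · z i j k with U
  -- i j k · z i k j, and these cancel. This pairing uses both copies, so the conclusion concerns
  -- the double of the sum.
  symmetric⇒2-torsion : (U : Fin n → Fin n → Fin n → ℤ) (z : Fin n → Fin n → Fin n → Carrier) →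
    (∀ i j k → U i j k ≡ U i k j) → (∀ i j k → z i j k ∙ z i k j ≈ ε) →
    combine³ U z ∙ combine³ U z ≈ ε
  symmetric⇒2-torsion {n} U z symmetric antisymmetric = begin
    combine³ U z ∙ combine³ U z
      ≈⟨ ∙-congˡ (sum-cong-≋ λ i → ∑-comm λ j k → U i j k · z i j k) ⟩
    combine³ U z ∙ sum³ (λ i j k → U i k j · z i k j)
      ≈⟨ ∙-congˡ (sum³-cong λ i j k → reflexive (≡.cong (_· z i k j) (symmetric i k j))) ⟩
    combine³ U z ∙ sum³ (λ i j k → U i j k · z i k j)
      ≈⟨ sum³-∙ (λ i j k → U i j k · z i j k) (λ i j k → U i j k · z i k j) ⟨
    sum³ (λ i j k → U i j k · z i j k ∙ U i j k · z i k j)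
      ≈⟨ sum³-cong (λ i j k → trans (sym (·ʳ.∙-homo (U i j k) _ _))
           (trans (·ʳ.cong (U i j k) (antisymmetric i j k)) (·ʳ.ε-homo (U i j k)))) ⟩
    combine³ {n} (λ _ _ _ → + 0) z
      ≈⟨ IsAdditive.ε-homo (combine³-additive z) ⟩
    ε ∎
    where module ·ʳ i = IsAdditive (·-additiveʳ i)

infix 7 _⊗³_
-- The pure tensor α ⊗ β ⊗ γ in the tensor cube of ℤⁿ.
_⊗³_ : (Fin n → ℤ) → (Fin n → ℤ) → (Fin n → ℤ) → Fin n → Fin n → Fin n → ℤ
(α ⊗³ β) γ i j k = α i ℤ.* (β j ℤ.* γ k)

record IsTrilinear (A : AbelianGroup a ℓa) (G : AbelianGroup g ℓg)
  (t : (x y z : AbelianGroup.Carrier A) → AbelianGroup.Carrier G) : Set (a ⊔ ℓa ⊔ ℓg) where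
  field
    additive₀ : ∀ y z → IsAdditive A G (λ x → t x y z)
    additive₁ : ∀ x z → IsAdditive A G (λ y → t x y z)
    additive₂ : ∀ x y → IsAdditive A G (λ z → t x y z)

  cong₃ : ∀ {x x′ y y′ z z′} → AbelianGroup._≈_ A x x′ → AbelianGroup._≈_ A y y′ → AbelianGroup._≈_ A z z′ →
          AbelianGroup._≈_ G (t x y z) (t x′ y′ z′)
  cong₃ p q r = AbelianGroup.trans G (IsAdditive.cong (additive₀ _ _) p)
    (AbelianGroup.trans G (IsAdditive.cong (additive₁ _ _) q) (IsAdditive.cong (additive₂ _ _) r))

  private
    module A = IntegerCombinations A
    module G where
      open AbelianGroup G public
      open IntegerCombinations G public
      open TripleCombinations G public
      open Sum commutativeMonoid public
  open SetoidReasoning G.setoid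

  -- A trilinear map factors through the tensor cube: the arguments are expanded one after the
  -- other, then the coefficients are gathered from the inside outwards.
  expand : (α β γ : Fin n → ℤ) (x : Fin n → AbelianGroup.Carrier A) →
           t (A.combine α x) (A.combine β x) (A.combine γ x) G.≈
           G.combine³ ((α ⊗³ β) γ) (λ i j k → t (x i) (x j) (x k))
  expand α β γ x = begin
    t (A.combine α x) (A.combine β x) (A.combine γ x)
      ≈⟨ combine-homo (additive₀ _ _) α x ⟩
    G.combine α (λ i → t (x i) (A.combine β x) (A.combine γ x))
      ≈⟨ G.combine-cong α (λ i → combine-homo (additive₁ _ _) β x) ⟩
    G.combine α (λ i → G.combine β λ j → t (x i) (x j) (A.combine γ x))
      ≈⟨ G.combine-cong α (λ i → G.combine-cong β λ j → combine-homo (additive₂ _ _) γ x) ⟩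
    G.combine α (λ i → G.combine β λ j → G.combine γ λ k → t (x i) (x j) (x k))
      ≈⟨ G.combine-cong α (λ i → G.sum-cong-≋ λ j → G.combine-* (β j) γ (λ k → t (x i) (x j) (x k))) ⟨
    G.combine α (λ i → G.sum λ j → G.combine (λ k → β j ℤ.* γ k) λ k → t (x i) (x j) (x k))
      ≈⟨ G.sum-cong-≋ (λ i → sum-homo (G.·-additiveʳ (α i)) λ j → G.combine (λ k → β j ℤ.* γ k) λ k → t (x i) (x j) (x k)) ⟩
    G.sum (λ i → G.sum λ j → α i G.· G.combine (λ k → β j ℤ.* γ k) λ k → t (x i) (x j) (x k))
      ≈⟨ G.sum-cong-≋ (λ i → G.sum-cong-≋ λ j → G.combine-* (α i) (λ k → β j ℤ.* γ k) (λ k → t (x i) (x j) (x k))) ⟨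
    G.combine³ ((α ⊗³ β) γ) (λ i j k → t (x i) (x j) (x k)) ∎

modulo₂-trilinear : {A : AbelianGroup a ℓa} {G : AbelianGroup g ℓg} {t : _} →
                    IsTrilinear A G t → IsTrilinear (modulo₂ A) (modulo₂ G) t
modulo₂-trilinear {A = A} {G} {t} trilinear = record
  { additive₀ = λ y z → modulo₂-additive {A = A} {G} {λ x → t x y z} (additive₀ y z)
  ; additive₁ = λ x z → modulo₂-additive {A = A} {G} {λ y → t x y z} (additive₁ x z)
  ; additive₂ = λ x y → modulo₂-additive {A = A} {G} {t x y} (additive₂ x y)
  }
  where open IsTrilinear trilinear

-- The two sides of the identity as formal expressions in the minors

_⊕_ : Fin 4 → ℕ → Fin 4
i ⊕ n = (toℕ i ℕ.+ n) mod 4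

-- The groups and the ternary operation are parameters because the same expressions are evaluated
-- twice: on minors in `F×` with t a b c = Dlog a ⊗ b ∧ c, and on exponent vectors in `ℤ^ 10` with t
-- the pure tensor.
module Expressions (A : AbelianGroup a ℓa) (G : AbelianGroup g ℓg)
                   (t : (x y z : AbelianGroup.Carrier A) → AbelianGroup.Carrier G) where
  open AbelianGroup A using () renaming (Carrier to |A|; _-_ to _/_)
  open AbelianGroup G using () renaming (Carrier to |G|; _∙_ to _+_; _⁻¹ to -_)

  -- This is `τ₀` of four vectors, where y i is the minor omitting the i-th one.
  tetrahedron : (Fin 4 → |A|) → |G|
  tetrahedron y = altSum G λ i → t (y i) (y (i ⊕ 1) / y (i ⊕ 2)) (y (i ⊕ 3) / y (i ⊕ 2))

  -- This is {r′, r, p} up to antisymmetry, with signs and order as in `∂ᴰ`; r′ stands for 1 - r and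
  -- p for the product of minors.
  cyclic : |A| → |A| → |A| → |G|
  cyclic r r′ p = (t r′ r p + - t r r′ p) + t p r′ r

  -- Here L is `τ₀ ∘ d` and R is -3 times `∂ᴰ ∘ τ₁`; the factor -1/3 is cleared so that all
  -- coefficients are integers.
  defect : (y : Fin 5 → Fin 4 → |A|) (r r′ p : Fin 5 → |A|) → |G|
  defect y r r′ p = ((L + L) + L) + R
    where
    L = altSum G λ i → tetrahedron (y i)
    R = altSum G λ i → cyclic (r i) (r′ i) (p i)

module _ {A : AbelianGroup a ℓa} {B : AbelianGroup b ℓb} {_~_ : REL (AbelianGroup.Carrier A) (AbelianGroup.Carrier B) ℓ}
         {G : AbelianGroup g ℓg} {H : AbelianGroup b ℓb} {_≋_ : REL (AbelianGroup.Carrier G) (AbelianGroup.Carrier H) ℓ′}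
         {t : (x y z : AbelianGroup.Carrier A) → AbelianGroup.Carrier G}
         {s : (x y z : AbelianGroup.Carrier B) → AbelianGroup.Carrier H}
         (~-rel : IsGroupRelation A B _~_) (≋-rel : IsGroupRelation G H _≋_)
         (t-rel : ∀ {x y z u v w} → x ~ u → y ~ v → z ~ w → t x y z ≋ s u v w) where
  private
    module ~ = IsGroupRelation ~-rel
    module ≋ = IsGroupRelation ≋-rel
    module S = Expressions A G t
    module T = Expressions B H s

  tetrahedron-rel : ∀ {y v} → (∀ i → y i ~ v i) → S.tetrahedron y ≋ T.tetrahedron v
  tetrahedron-rel y~v = ≋.altSum-rel {n = 4} λ i → t-rel (y~v i)
    (~.∙-rel (y~v (i ⊕ 1)) (~.⁻¹-rel (y~v (i ⊕ 2))))
    (~.∙-rel (y~v (i ⊕ 3)) (~.⁻¹-rel (y~v (i ⊕ 2))))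

  cyclic-rel : ∀ {r r′ p u u′ q} → r ~ u → r′ ~ u′ → p ~ q → S.cyclic r r′ p ≋ T.cyclic u u′ q
  cyclic-rel ρ ρ′ π = ≋.∙-rel (≋.∙-rel (t-rel ρ′ ρ π) (≋.⁻¹-rel (t-rel ρ ρ′ π))) (t-rel π ρ′ ρ)

  -- Parametricity: `defect` uses only group operations and the ternary map, so coordinates of its
  -- inputs determine coordinates of its value.
  defect-rel : ∀ {y r r′ p v u u′ q} → (∀ i j → y i j ~ v i j) →
               (∀ i → r i ~ u i) → (∀ i → r′ i ~ u′ i) → (∀ i → p i ~ q i) →
               S.defect y r r′ p ≋ T.defect v u u′ q
  defect-rel y~v r~u r′~u′ p~q = ≋.∙-rel (≋.∙-rel (≋.∙-rel L L) L)
    (≋.altSum-rel {n = 5} λ i → cyclic-rel (r~u i) (r′~u′ i) (p~q i))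
    where L = ≋.altSum-rel {n = 5} λ i → tetrahedron-rel (y~v i)

-- The minors of (l₀, …, l₄) are numbered 0, …, 9 in the lexicographic order of the
-- triples 012, 013, …, 234.  Row i of `edges` contains the minors omitting lᵢ, ordered
-- by the other omitted vector; row i of `links` contains those involving lᵢ, in the
-- lexicographic order of the pairs of other vectors.

edges : Vec (Vec (Fin 10) 4) 5
edges =
  (9F ∷ 8F ∷ 7F ∷ 6F ∷ []) ∷
  (9F ∷ 5F ∷ 4F ∷ 3F ∷ []) ∷
  (8F ∷ 5F ∷ 2F ∷ 1F ∷ []) ∷
  (7F ∷ 4F ∷ 2F ∷ 0F ∷ []) ∷
  (6F ∷ 3F ∷ 1F ∷ 0F ∷ []) ∷ []

links : Vec (Vec (Fin 10) 6) 5
links =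
  (0F ∷ 1F ∷ 2F ∷ 3F ∷ 4F ∷ 5F ∷ []) ∷
  (0F ∷ 1F ∷ 2F ∷ 6F ∷ 7F ∷ 8F ∷ []) ∷
  (0F ∷ 3F ∷ 4F ∷ 6F ∷ 7F ∷ 9F ∷ []) ∷
  (1F ∷ 3F ∷ 5F ∷ 6F ∷ 8F ∷ 9F ∷ []) ∷
  (2F ∷ 4F ∷ 5F ∷ 7F ∷ 8F ∷ 9F ∷ []) ∷ []

edge : Fin 5 → Fin 4 → Fin 10
edge i = lookup (lookup edges i)

link : Fin 5 → Fin 6 → Fin 10
link i = lookup (lookup links i)

-- When v p are the minors involving a vector, ordered as in `links`, the projected
-- cross-ratio from that vector is `cross`, and `cross′` is its complement to 1.
module _ (A : AbelianGroup a ℓa) (v : Fin 6 → AbelianGroup.Carrier A) where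
  open AbelianGroup A renaming (_-_ to _/_)

  cross cross′ : Carrier
  cross  = (v 2F ∙ v 3F) / (v 1F ∙ v 4F)
  cross′ = (v 0F ∙ v 5F) / (v 1F ∙ v 4F)

module _ {A : AbelianGroup a ℓa} {B : AbelianGroup b ℓb} {_~_ : REL (AbelianGroup.Carrier A) (AbelianGroup.Carrier B) ℓ}
         (~-rel : IsGroupRelation A B _~_)
         {v : Fin 6 → AbelianGroup.Carrier A} {u : Fin 6 → AbelianGroup.Carrier B} (v~u : ∀ p → v p ~ u p) where
  open IsGroupRelation ~-rel

  cross-rel : cross A v ~ cross B u
  cross-rel = ∙-rel (∙-rel (v~u 2F) (v~u 3F)) (⁻¹-rel (∙-rel (v~u 1F) (v~u 4F)))

  cross′-rel : cross′ A v ~ cross′ B u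
  cross′-rel = ∙-rel (∙-rel (v~u 0F) (v~u 5F)) (⁻¹-rel (∙-rel (v~u 1F) (v~u 4F)))

-- The coefficients of `defect` when the ten minors are independent.  As b ∧ c + c ∧ b = 0,
-- their symmetry in the last two indices means that `defect` is 2-torsion.
universal : Fin 10 → Fin 10 → Fin 10 → ℤ
universal = Expressions.defect (ℤ^ 10) (ℤ^ 10 ³) (λ α β γ → (α ⊗³ β) γ)
  (λ i j → δᵢ (edge i j)) (λ i → cross (ℤ^ 10) (δᵢ ∘ link i)) (λ i → cross′ (ℤ^ 10) (δᵢ ∘ link i))
  (λ i → Sum.sum (AbelianGroup.commutativeMonoid (ℤ^ 10)) (δᵢ ∘ edge i))

abstract
  -- The combinatorial core, where the path terms cancel and the star terms match: a finite
  -- comparison of integers, one for each of the 1000 index triples, decided by evaluation.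
  universal-symmetric : ∀ i j k → universal i j k ≡ universal i k j
  universal-symmetric = from-yes (all? λ i → all? λ j → all? λ k → universal i j k ℤ.≟ universal i k j)

-- Specialization of the universal identity to given elements

module Coordinates {A : AbelianGroup a ℓa} {G : AbelianGroup g ℓg}
         {t : (x y z : AbelianGroup.Carrier A) → AbelianGroup.Carrier G}
         (trilinear : IsTrilinear A G t)
         (antisymmetric : ∀ x y z → AbelianGroup._≈_ G (AbelianGroup._∙_ G (t x y z) (t x z y)) (AbelianGroup.ε G))
         (x : Fin n → AbelianGroup.Carrier A) where
  private
    module A₂ = AbelianGroup (modulo₂ A)
    module G₂ = AbelianGroup (modulo₂ G)
    module A = IntegerCombinations A
    module G = TripleCombinations G

    z : Fin n → Fin n → Fin n → AbelianGroup.Carrier G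
    z i j k = t (x i) (x j) (x k)

  -- In multiplicative notation, u ~ α means that u is the monomial with factors xᵢ to the power αᵢ,
  -- up to 2-torsion. An element may have several coordinate vectors, so this is a relation and not
  -- a map.
  _~_ : REL A₂.Carrier (Fin n → ℤ) _
  _~_ = Graph (modulo₂ A) (λ α → A.combine α x)

  _≋_ : REL G₂.Carrier (Fin n → Fin n → Fin n → ℤ) _
  _≋_ = Graph (modulo₂ G) (λ U → G.combine³ U z)

  ~-rel : IsGroupRelation (modulo₂ A) (ℤ^ n) _~_
  ~-rel = graph-rel (into-modulo₂ (A.combine-additive x))

  ≋-rel : IsGroupRelation (modulo₂ G) (ℤ^ n ³) _≋_
  ≋-rel = graph-rel (into-modulo₂ (G.combine³-additive z))

  t-rel : ∀ {u v w α β γ} → u ~ α → v ~ β → w ~ γ → t u v w ≋ (α ⊗³ β) γ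
  t-rel {α = α} {β} {γ} (graph u~α) (graph v~β) (graph w~γ) = graph
    (G₂.trans (IsTrilinear.cong₃ (modulo₂-trilinear trilinear) u~α v~β w~γ)
      (≈⇒≈₂ G (IsTrilinear.expand trilinear α β γ x)))

  ~-δ : ∀ {u} i → u A₂.≈ x i → u ~ δᵢ i
  ~-δ i u≈xᵢ = graph (A₂.trans u≈xᵢ (≈⇒≈₂ A (AbelianGroup.sym A (A.combine-δ i x))))

  ~-respˡ : ∀ u v {α} → AbelianGroup._≈_ A u v → v ~ α → u ~ α
  ~-respˡ u v u≈v (graph v~α) = graph (A₂.trans (≈⇒≈₂ A u≈v) v~α)

  symmetric⇒≈₂ε : ∀ {v U} → v ≋ U → (∀ i j k → U i j k ≡ U i k j) → v G₂.≈ G₂.ε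
  symmetric⇒≈₂ε {U = U} (graph v≋U) symmetric = G₂.trans v≋U
    (square-ε⇒≈₂ε G (G.symmetric⇒2-torsion U z symmetric λ i j k → antisymmetric _ _ _))

module _ {A : AbelianGroup a ℓa} {G : AbelianGroup g ℓg}
         {t : (x y z : AbelianGroup.Carrier A) → AbelianGroup.Carrier G}
         (trilinear : IsTrilinear A G t)
         (antisymmetric : ∀ x y z → AbelianGroup._≈_ G (AbelianGroup._∙_ G (t x y z) (t x z y)) (AbelianGroup.ε G))
         (x : Fin 10 → AbelianGroup.Carrier A) where
  private
    module A₂ = AbelianGroup (modulo₂ A)
    module G = AbelianGroup G
    module G₂ = AbelianGroup (modulo₂ G)
  open Coordinates trilinear antisymmetric x
  open Expressions A G t

  -- The inputs have the same coordinates as in `universal`, so `defect` has the coefficients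
  -- `universal`; their symmetry makes it 2-torsion.
  defect-vanishes : ∀ y r r′ p →
    (∀ i j → y i j ~ δᵢ (edge i j)) →
    (∀ i → r i ~ cross (ℤ^ 10) (δᵢ ∘ link i)) → (∀ i → r′ i ~ cross′ (ℤ^ 10) (δᵢ ∘ link i)) →
    (∀ i → p i ~ Sum.sum (AbelianGroup.commutativeMonoid (ℤ^ 10)) (δᵢ ∘ edge i)) →
    defect y r r′ p G₂.≈ G₂.ε
  defect-vanishes y r r′ p y~ r~ r′~ p~ = symmetric⇒≈₂ε represented universal-symmetric
    where
    represented : defect y r r′ p ≋ universal
    represented = defect-rel ~-rel ≋-rel t-rel y~ r~ r′~ p~

  square-commutes : ∀ y r r′ p →
    (∀ i j → y i j ~ δᵢ (edge i j)) →
    (∀ i → r i ~ cross (ℤ^ 10) (δᵢ ∘ link i)) → (∀ i → r′ i ~ cross′ (ℤ^ 10) (δᵢ ∘ link i)) →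
    (∀ i → p i ~ Sum.sum (AbelianGroup.commutativeMonoid (ℤ^ 10)) (δᵢ ∘ edge i)) →
    (X Y : Fin 5 → G.Carrier) →
    (∀ i → X i G.≈ tetrahedron (y i)) → (∀ i → Y i G.≈ cyclic (r i) (r′ i) (p i)) →
    ((altSum G X G.∙ altSum G X) G.∙ altSum G X) G.∙ altSum G Y G₂.≈ G₂.ε
  square-commutes y r r′ p y~ r~ r′~ p~ X Y X≈ Y≈ = G₂.trans
    (≈⇒≈₂ G (G.∙-cong (G.∙-cong (G.∙-cong L L) L) (altSum-rel Y≈)))
    (defect-vanishes y r r′ p y~ r~ r′~ p~)
    where
    open IsGroupRelation (≈-rel G) using (altSum-rel)
    L = altSum-rel {f = X} {h = tetrahedron ∘ y} X≈

module _ (A : AbelianGroup a ℓa) (G : AbelianGroup g ℓg) where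
  private
    module A = AbelianGroup A
    open AbelianGroup G
    open SetoidReasoning setoid

  -- Polarization: expand f at (x ∙ y, x ∙ y). It serves both the wedge product and the volume form.
  alternating⇒antisymmetric : (f : A.Carrier → A.Carrier → Carrier) →
    (∀ y → IsAdditive A G (λ x → f x y)) → (∀ x → IsAdditive A G (f x)) →
    (∀ x → f x x ≈ ε) → ∀ x y → f x y ∙ f y x ≈ ε
  alternating⇒antisymmetric f additiveˡ additiveʳ alternating x y = begin
    f x y ∙ f y x                         ≈⟨ ∙-cong (identityˡ _) (identityʳ _) ⟨
    (ε ∙ f x y) ∙ (f y x ∙ ε)             ≈⟨ ∙-cong (∙-congʳ (alternating x)) (∙-congˡ (alternating y)) ⟨
    (f x x ∙ f x y) ∙ (f y x ∙ f y y)     ≈⟨ ∙-cong (ʳ.∙-homo x x y) (ʳ.∙-homo y x y) ⟨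
    f x (x A.∙ y) ∙ f y (x A.∙ y)         ≈⟨ IsAdditive.∙-homo (additiveˡ (x A.∙ y)) x y ⟨
    f (x A.∙ y) (x A.∙ y)                 ≈⟨ alternating (x A.∙ y) ⟩
    ε                                     ∎
    where module ʳ x = IsAdditive (additiveʳ x)

-- The square over a field

module _ {c ℓ₁ ℓ₂ : Level} (F : HeytingField c ℓ₁ ℓ₂) where
  open Field F
  private module × = AbelianGroup F×

  -- Since k = m - n. For a projected cross-ratio the equation k + n = m is the Plücker relation, so
  -- 1 - r is again a quotient of products of minors.
  ratio-one-minus : ∀ n m k eq → val (one-minus (ratio n m k eq)) ≈ val (k / m)
  ratio-one-minus n m k k+n≈m = begin
    1# - val n * m⁻¹                            ≈⟨ +-congʳ (trans (*-comm _ _) (⁻¹-inverseˡ m)) ⟨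
    val m * m⁻¹ - val n * m⁻¹                   ≈⟨ +-congʳ (*-congʳ k+n≈m) ⟨
    (val k + val n) * m⁻¹ - val n * m⁻¹         ≈⟨ +-congʳ (distribʳ _ _ _) ⟩
    val k * m⁻¹ + val n * m⁻¹ - val n * m⁻¹     ≈⟨ +-assoc _ _ _ ⟩
    val k * m⁻¹ + (val n * m⁻¹ - val n * m⁻¹)   ≈⟨ +-congˡ (-‿inverseʳ _) ⟩
    val k * m⁻¹ + 0#                            ≈⟨ +-identityʳ _ ⟩
    val k * m⁻¹                                 ∎
    where
    open SetoidReasoning setoid
    m⁻¹ = val (m ⁻¹)

  -- From a = -b follows a² = b². This absorbs all signs that come from reordering the columns of
  -- minors.
  opposite⇒≈₂ : ∀ a b → val a + val b ≈ 0# → a ≈ b mod2 F×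
  opposite⇒≈₂ a b a+b≈0 = equal-squares⇒≈₂ F× {a} {b} (begin
    val a * val a         ≈⟨ *-cong a≈-b a≈-b ⟩
    - val b * - val b     ≈⟨ -‿distribˡ-* _ _ ⟨
    - (val b * - val b)   ≈⟨ -‿cong (-‿distribʳ-* _ _) ⟨
    - - (val b * val b)   ≈⟨ ⁻¹-involutive _ ⟩
    val b * val b         ∎)
    where
    open SetoidReasoning setoid
    open AbelianGroupProperties +-abelianGroup using (inverseˡ-unique; ⁻¹-involutive)
    open RingProperties ring using (-‿distribˡ-*; -‿distribʳ-*)
    a≈-b : val a ≈ - val b
    a≈-b = inverseˡ-unique _ _ a+b≈0

  module _ (𝒟 : Derivation) where
    open Derivation 𝒟
    open WithDerivation 𝒟

    target : AbelianGroup _ _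
    target = LeftModule.+ᴹ-abelianGroup Target

    source : AbelianGroup _ _
    source = LeftModule.+ᴹ-abelianGroup Source

    -- The Leibniz rule for ab, divided by ab.
    Dlog-additive : IsAdditive F× +-abelianGroup Dlog
    Dlog-additive = record
      { cong = λ {a} {b} a≈b → *-cong (D-cong a≈b) (×.⁻¹-cong {a} {b} a≈b)
      ; ∙-homo = λ a b → begin
          D (val a * val b) * val ((a ∙ b) ⁻¹)
            ≈⟨ *-cong (leibniz _ _) (sym (⁻¹-∙-comm a b)) ⟩
          (val a * D (val b) + val b * D (val a)) * (val (a ⁻¹) * val (b ⁻¹))
            ≈⟨ distribʳ _ _ _ ⟩
          val a * D (val b) * (val (a ⁻¹) * val (b ⁻¹)) + val b * D (val a) * (val (a ⁻¹) * val (b ⁻¹))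
            ≈⟨ +-comm _ _ ⟩
          val b * D (val a) * (val (a ⁻¹) * val (b ⁻¹)) + val a * D (val b) * (val (a ⁻¹) * val (b ⁻¹))
            ≈⟨ +-cong (trans (*-congˡ (*-comm _ _)) (cancel b (D (val a)) _)) (cancel a (D (val b)) _) ⟩
          Dlog a + Dlog b ∎
      }
      where
      open SetoidReasoning setoid
      open AbelianGroupProperties F× using (⁻¹-∙-comm)
      open CommutativeSemigroupProperties *-commutativeSemigroup using (interchange)
      cancel : ∀ u x y → val u * x * (val (u ⁻¹) * y) ≈ x * y
      cancel u x y = trans (interchange _ _ _ _)
        (trans (*-congʳ (×.inverseʳ u)) (*-identityˡ _))

    module ⋀² = AbelianGroup ⋀²

    ∧-additiveˡ : ∀ b → IsAdditive F× ⋀² (_∧ b)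
    ∧-additiveˡ b = record
      { cong = λ a≈a′ → gen-cong (a≈a′ , refl)
      ; ∙-homo = λ a a′ → relation (additiveˡ a a′ b)
      }
      where
      open AbelianPresentation using (gen-cong; relation)
      open ExteriorSquare using (additiveˡ; additiveʳ)

    ∧-additiveʳ : ∀ a → IsAdditive F× ⋀² (a ∧_)
    ∧-additiveʳ a = record
      { cong = λ b≈b′ → gen-cong (refl , b≈b′)
      ; ∙-homo = λ b b′ → relation (additiveʳ a b b′)
      }
      where
      open AbelianPresentation using (gen-cong; relation)
      open ExteriorSquare using (additiveˡ; additiveʳ)

    ∧-antisymmetric : ∀ a b → (a ∧ b) ⋀².∙ (b ∧ a) ⋀².≈ ⋀².ε
    ∧-antisymmetric = alternating⇒antisymmetric F× ⋀² _∧_ ∧-additiveˡ ∧-additiveʳ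
      λ a → AbelianPresentation.relation (ExteriorSquare.alternating a)

    open F⊗⋀² using (_⊗_)

    ⊗-additiveˡ : ∀ w → IsAdditive +-abelianGroup target (_⊗ w)
    ⊗-additiveˡ w = record
      { cong = λ x≈y → ModulePresentation.gen-cong (x≈y , ⋀².refl)
      ; ∙-homo = λ x y → ModulePresentation.relation (Tensor.additiveˡ x y w)
      }

    ⊗-additiveʳ : ∀ x → IsAdditive ⋀² target (x ⊗_)
    ⊗-additiveʳ x = record
      { cong = λ v≈w → ModulePresentation.gen-cong (refl , v≈w)
      ; ∙-homo = λ v w → ModulePresentation.relation (Tensor.additiveʳ x v w)
      }

    Dlog⊗∧ : (a b c : NonZero) → AbelianGroup.Carrier target
    Dlog⊗∧ a b c = Dlog a ⊗ (b ∧ c)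

    private module T = AbelianGroup target

    Dlog⊗∧-trilinear : IsTrilinear F× target Dlog⊗∧
    Dlog⊗∧-trilinear = record
      { additive₀ = λ b c → compose Dlog-additive (⊗-additiveˡ (b ∧ c))
      ; additive₁ = λ a c → compose (∧-additiveˡ c) (⊗-additiveʳ (Dlog a))
      ; additive₂ = λ a b → compose (∧-additiveʳ b) (⊗-additiveʳ (Dlog a))
      }

    Dlog⊗∧-antisymmetric : ∀ a b c → Dlog⊗∧ a b c T.∙ Dlog⊗∧ a c b T.≈ T.ε
    Dlog⊗∧-antisymmetric a b c = T.trans (T.sym (∙-homo (b ∧ c) (c ∧ b)))
      (T.trans (cong (∧-antisymmetric b c)) ε-homo)
      where open IsAdditive (⊗-additiveʳ (Dlog a))

    -- `∂ᴰ` is computed by recursion on representatives, so it preserves the operations of each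
    -- summand by definition; only the sum of its two components has to be rearranged. Independence
    -- of the representative is not asserted.
    ∂ᴰ-rel : IsGroupRelation target source (Graph target ∂ᴰ)
    ∂ᴰ-rel = record
      { ∙-rel = λ (graph p) (graph q) → graph (T.trans (T.∙-cong p q) (interchange _ _ _ _))
      ; ε-rel = graph (T.sym (T.identityˡ T.ε))
      ; ⁻¹-rel = λ (graph p) → graph (T.trans (T.⁻¹-cong p) (T.sym (⁻¹-∙-comm _ _)))
      }
      where
      open AbelianGroupProperties target using (⁻¹-∙-comm)
      open CommutativeSemigroupProperties T.commutativeSemigroup using (interchange)

    ∂ᴰ-*ₗ-rel : ∀ k {x u} → Graph target ∂ᴰ x u →
                Graph target ∂ᴰ (LeftModule._*ₗ_ Target k x) (LeftModule._*ₗ_ Source k u)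
    ∂ᴰ-*ₗ-rel k (graph x≈∂u) = graph
      (T.trans (LeftModule.*ₗ-congˡ Target x≈∂u) (LeftModule.*ₗ-distribˡ Target k _ _))

  module _ {m ℓm : Level} (M : LeftModule ring m ℓm) (3#0 : 1# + 1# + 1# # 0#) where
    open LeftModule M
    private
      module M₂ = AbelianGroup (modulo₂ +ᴹ-abelianGroup)

      ⅓ : Carrier
      ⅓ = val (nonZero (1# + 1# + 1#) 3#0 ⁻¹)

      ⅓-additive : IsAdditive +ᴹ-abelianGroup +ᴹ-abelianGroup (⅓ *ₗ_)
      ⅓-additive = record { cong = *ₗ-congˡ ; ∙-homo = *ₗ-distribˡ ⅓ }

      ⅓-3 : ∀ u → ⅓ *ₗ ((u +ᴹ u) +ᴹ u) ≈ᴹ u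
      ⅓-3 u = begin
        ⅓ *ₗ ((u +ᴹ u) +ᴹ u)                       ≈⟨ *ₗ-congˡ (+ᴹ-cong (+ᴹ-cong 1u 1u) 1u) ⟨
        ⅓ *ₗ ((1# *ₗ u +ᴹ 1# *ₗ u) +ᴹ 1# *ₗ u)     ≈⟨ *ₗ-congˡ (+ᴹ-congʳ (*ₗ-distribʳ u 1# 1#)) ⟨
        ⅓ *ₗ ((1# + 1#) *ₗ u +ᴹ 1# *ₗ u)           ≈⟨ *ₗ-congˡ (*ₗ-distribʳ u (1# + 1#) 1#) ⟨
        ⅓ *ₗ (1# + 1# + 1#) *ₗ u                   ≈⟨ *ₗ-assoc _ _ u ⟨
        (⅓ * (1# + 1# + 1#)) *ₗ u                  ≈⟨ *ₗ-congʳ (⁻¹-inverseˡ (nonZero (1# + 1# + 1#) 3#0)) ⟩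
        1# *ₗ u                                    ≈⟨ 1u ⟩
        u                                          ∎
        where
        open SetoidReasoning ≈ᴹ-setoid
        1u = *ₗ-identityˡ u

    -- Multiplication by 1/3 is additive, hence respects equality modulo 2-torsion, and turns the
    -- hypothesis into u + v/3 = 0.
    3u+v≈₂0⇒u≈₂-⅓v : ∀ u v → ((u +ᴹ u) +ᴹ u) +ᴹ v M₂.≈ 0ᴹ → u M₂.≈ - ⅓ *ₗ v
    3u+v≈₂0⇒u≈₂-⅓v u v 3u+v≈₂0 = begin
      u                                    ≈⟨ inverseˡ-unique _ _ u+⅓v≈₂0 ⟩
      -ᴹ (⅓ *ₗ v)                          ≈⟨ ≈⇒≈₂ +ᴹ-abelianGroup (IsAdditive.⁻¹-homo *v-additive ⅓) ⟨
      - ⅓ *ₗ v                             ∎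
      where
      open SetoidReasoning M₂.setoid
      open AbelianGroupProperties (modulo₂ +ᴹ-abelianGroup) using (inverseˡ-unique)

      *v-additive : IsAdditive +-abelianGroup +ᴹ-abelianGroup (_*ₗ v)
      *v-additive = record { cong = *ₗ-congʳ ; ∙-homo = *ₗ-distribʳ v }

      u+⅓v≈₂0 : u +ᴹ ⅓ *ₗ v M₂.≈ 0ᴹ
      u+⅓v≈₂0 = begin
        u +ᴹ ⅓ *ₗ v                              ≈⟨ ≈⇒≈₂ +ᴹ-abelianGroup (+ᴹ-congʳ (⅓-3 u)) ⟨
        ⅓ *ₗ ((u +ᴹ u) +ᴹ u) +ᴹ ⅓ *ₗ v           ≈⟨ ≈⇒≈₂ +ᴹ-abelianGroup (*ₗ-distribˡ ⅓ _ v) ⟨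
        ⅓ *ₗ (((u +ᴹ u) +ᴹ u) +ᴹ v)              ≈⟨ IsAdditive.cong (modulo₂-additive ⅓-additive) 3u+v≈₂0 ⟩
        ⅓ *ₗ 0ᴹ                                  ≈⟨ ≈⇒≈₂ +ᴹ-abelianGroup (*ₗ-zeroʳ ⅓) ⟩
        0ᴹ                                       ∎

  module _ {m ℓm : Level} (V₃ : LeftModule ring m ℓm) where
    open VectorSpace V₃
    open LeftModule V₃ using (+ᴹ-abelianGroup)

    linear-form-additive : ∀ {φ} → IsLinearForm φ → IsAdditive +ᴹ-abelianGroup +-abelianGroup φ
    linear-form-additive linear = record { cong = ⟦⟧-cong ; ∙-homo = +ᴹ-homo }
      where open LeftModuleMorphisms.IsLeftModuleHomomorphism linear

    module _ (ω : VolumeForm) where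
      open VolumeForm ω

      Δ-swap₀₁ : ∀ u v w → Δ u v w + Δ v u w ≈ 0#
      Δ-swap₀₁ u v w = alternating⇒antisymmetric +ᴹ-abelianGroup +-abelianGroup (λ u v → Δ u v w)
        (λ v → linear-form-additive (linear₀ v w)) (λ u → linear-form-additive (linear₁ u w))
        (λ u → alt₀₁ u w) u v

      Δ-swap₁₂ : ∀ u v w → Δ u v w + Δ u w v ≈ 0#
      Δ-swap₁₂ u = alternating⇒antisymmetric +ᴹ-abelianGroup +-abelianGroup (Δ u)
        (λ w → linear-form-additive (linear₁ u w)) (λ v → linear-form-additive (linear₂ u v))
        (alt₁₂ u)

      -- A 3-cycle is a product of two transpositions, so the two signs cancel.
      Δ-rotate : ∀ u v w → Δ u v w ≈ Δ v w u
      Δ-rotate u v w = trans (inverseˡ-unique _ _ (Δ-swap₀₁ u v w))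
        (sym (inverseʳ-unique _ _ (Δ-swap₁₂ v u w)))
        where open AbelianGroupProperties +-abelianGroup using (inverseˡ-unique; inverseʳ-unique)

-- The minors of five vectors, and commutativity of the square

module Commutativity {c ℓ₁ ℓ₂ m ℓm : Level} (F : HeytingField c ℓ₁ ℓ₂) (V₃ : LeftModule (Field.ring F) m ℓm) where
  open Field F
  open VectorSpace V₃
  private module ×₂ = AbelianGroup (modulo₂ F×)

  module _ (B : Basis 3) (ω : VolumeForm) where
    open VolumeForm ω
    open Geometry B ω

    minor : Configuration 5 → Fin 10 → NonZero
    minor l 0F = Δ× l 0F 1F 2F
    minor l 1F = Δ× l 0F 1F 3F
    minor l 2F = Δ× l 0F 1F 4F
    minor l 3F = Δ× l 0F 2F 3F
    minor l 4F = Δ× l 0F 2F 4F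
    minor l 5F = Δ× l 0F 3F 4F
    minor l 6F = Δ× l 1F 2F 3F
    minor l 7F = Δ× l 1F 2F 4F
    minor l 8F = Δ× l 1F 3F 4F
    minor l 9F = Δ× l 2F 3F 4F

    -- In lexicographic order the first six of the ten triples are those containing 0; after
    -- `move-to-front i` they give the minors involving lᵢ.
    first-minor : Configuration 5 → Fin 6 → NonZero
    first-minor l p = minor l (p ↑ˡ 4)

    -- Deletion keeps the order of the remaining vectors, so no sign appears.
    Δ̂-minor : ∀ l i j → val (Δ̂ (delete i l) j) ≈ val (minor l (edge i j))
    Δ̂-minor l 0F 0F = refl
    Δ̂-minor l 0F 1F = refl
    Δ̂-minor l 0F 2F = refl
    Δ̂-minor l 0F 3F = refl
    Δ̂-minor l 1F 0F = refl
    Δ̂-minor l 1F 1F = refl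
    Δ̂-minor l 1F 2F = refl
    Δ̂-minor l 1F 3F = refl
    Δ̂-minor l 2F 0F = refl
    Δ̂-minor l 2F 1F = refl
    Δ̂-minor l 2F 2F = refl
    Δ̂-minor l 2F 3F = refl
    Δ̂-minor l 3F 0F = refl
    Δ̂-minor l 3F 1F = refl
    Δ̂-minor l 3F 2F = refl
    Δ̂-minor l 3F 3F = refl
    Δ̂-minor l 4F 0F = refl
    Δ̂-minor l 4F 1F = refl
    Δ̂-minor l 4F 2F = refl
    Δ̂-minor l 4F 3F = refl

    -- Bringing lᵢ from the front to its sorted place moves it past zero, one or two vectors: the
    -- minor is unchanged, changes sign by a transposition, or is unchanged by a rotation.
    first-minor-link-± : ∀ l i p →
      val (first-minor (move-to-front i l) p) ≈ val (minor l (link i p)) ⊎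
      val (first-minor (move-to-front i l) p) + val (minor l (link i p)) ≈ 0#
    first-minor-link-± l 0F 0F = inj₁ refl
    first-minor-link-± l 0F 1F = inj₁ refl
    first-minor-link-± l 0F 2F = inj₁ refl
    first-minor-link-± l 0F 3F = inj₁ refl
    first-minor-link-± l 0F 4F = inj₁ refl
    first-minor-link-± l 0F 5F = inj₁ refl
    first-minor-link-± l 1F 0F = inj₂ (Δ-swap₀₁ F V₃ ω _ _ _)
    first-minor-link-± l 1F 1F = inj₂ (Δ-swap₀₁ F V₃ ω _ _ _)
    first-minor-link-± l 1F 2F = inj₂ (Δ-swap₀₁ F V₃ ω _ _ _)
    first-minor-link-± l 1F 3F = inj₁ refl
    first-minor-link-± l 1F 4F = inj₁ refl
    first-minor-link-± l 1F 5F = inj₁ refl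
    first-minor-link-± l 2F 0F = inj₁ (Δ-rotate F V₃ ω _ _ _)
    first-minor-link-± l 2F 1F = inj₂ (Δ-swap₀₁ F V₃ ω _ _ _)
    first-minor-link-± l 2F 2F = inj₂ (Δ-swap₀₁ F V₃ ω _ _ _)
    first-minor-link-± l 2F 3F = inj₂ (Δ-swap₀₁ F V₃ ω _ _ _)
    first-minor-link-± l 2F 4F = inj₂ (Δ-swap₀₁ F V₃ ω _ _ _)
    first-minor-link-± l 2F 5F = inj₁ refl
    first-minor-link-± l 3F 0F = inj₁ (Δ-rotate F V₃ ω _ _ _)
    first-minor-link-± l 3F 1F = inj₁ (Δ-rotate F V₃ ω _ _ _)
    first-minor-link-± l 3F 2F = inj₂ (Δ-swap₀₁ F V₃ ω _ _ _)
    first-minor-link-± l 3F 3F = inj₁ (Δ-rotate F V₃ ω _ _ _)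
    first-minor-link-± l 3F 4F = inj₂ (Δ-swap₀₁ F V₃ ω _ _ _)
    first-minor-link-± l 3F 5F = inj₂ (Δ-swap₀₁ F V₃ ω _ _ _)
    first-minor-link-± l 4F 0F = inj₁ (Δ-rotate F V₃ ω _ _ _)
    first-minor-link-± l 4F 1F = inj₁ (Δ-rotate F V₃ ω _ _ _)
    first-minor-link-± l 4F 2F = inj₁ (Δ-rotate F V₃ ω _ _ _)
    first-minor-link-± l 4F 3F = inj₁ (Δ-rotate F V₃ ω _ _ _)
    first-minor-link-± l 4F 4F = inj₁ (Δ-rotate F V₃ ω _ _ _)
    first-minor-link-± l 4F 5F = inj₁ (Δ-rotate F V₃ ω _ _ _)

    module _ (𝒟 : Derivation) where
      open Derivation 𝒟
      open WithDerivation 𝒟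
      open Maps 𝒟
      private
        G = target F 𝒟
        module G = AbelianGroup G
        module G₂ = AbelianGroup (modulo₂ G)
      open Expressions F× G (Dlog⊗∧ F 𝒟)
      open AbelianPresentation using (gen; 0ᵗ; _+ᵗ_; -ᵗ_)

      -- The i-th term of `τ₁`, without its sign and the factor -1/3, for r = `r̂ l i` and p =
      -- `∏Δ̂ l i`.
      summand : F•• → NonZero → AbelianGroup.Carrier (source F 𝒟)
      summand r p = ⟦ r ⟧₂ βᴰ₂⊗F×.⊗ p , Dlog p F⊗B₂.⊗ [ r ]₂

      τ₀-rel : IsGroupRelation G (C 4) (Graph G τ₀)
      τ₀-rel = record
        { ∙-rel = λ (graph p) (graph q) → graph (G.∙-cong p q)
        ; ε-rel = graph G.refl
        ; ⁻¹-rel = λ (graph p) → graph (G.⁻¹-cong p)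
        }

      module _ (l : Configuration 5) where
        open Coordinates (Dlog⊗∧-trilinear F 𝒟) (Dlog⊗∧-antisymmetric F 𝒟) (minor l)

        first-minor-rel : ∀ i p → first-minor (move-to-front i l) p ~ δᵢ (link i p)
        first-minor-rel i p = ~-δ (link i p)
          ([ ≈⇒≈₂ F× {u} {v} , opposite⇒≈₂ F u v ]′ (first-minor-link-± l i p))
          where
          u = first-minor (move-to-front i l) p
          v = minor l (link i p)

        Δ̂-rel : ∀ i j → Δ̂ (delete i l) j ~ δᵢ (edge i j)
        Δ̂-rel i j = ~-δ (edge i j) (≈⇒≈₂ F× {Δ̂ (delete i l) j} {minor l (edge i j)} (Δ̂-minor l i j))

        module _ (i : Fin 5) where
          private
            l′ = move-to-front i l
            module ~ = IsGroupRelation ~-rel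

          unit-r̂-rel : unit (r̂ l i) ~ cross (ℤ^ 10) (δᵢ ∘ link i)
          -- The cross-ratio and `cross` of the first six minors have the same value by definition.
          unit-r̂-rel = ~-respˡ (unit (r̂ l i)) (cross (modulo₂ F×) (first-minor l′)) refl
            (cross-rel ~-rel {v = first-minor l′} {u = δᵢ ∘ link i} (first-minor-rel i))

          one-minus-r̂-rel : one-minus (r̂ l i) ~ cross′ (ℤ^ 10) (δᵢ ∘ link i)
          one-minus-r̂-rel = ~-respˡ (one-minus (r̂ l i)) (cross′ (modulo₂ F×) (first-minor l′)) 1-r̂
            (cross′-rel ~-rel {v = first-minor l′} {u = δᵢ ∘ link i} (first-minor-rel i))
            where
            1-r̂ : val (one-minus (r̂ l i)) ≈ val (cross′ (modulo₂ F×) (first-minor l′))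
            1-r̂ = ratio-one-minus F
              (first-minor l′ 2F ∙ first-minor l′ 3F)
              (first-minor l′ 1F ∙ first-minor l′ 4F)
              (first-minor l′ 0F ∙ first-minor l′ 5F)
              (plücker _ _ _ _ _)

          ∏Δ̂-rel : ∏Δ̂ l i ~ Sum.sum (AbelianGroup.commutativeMonoid (ℤ^ 10)) (δᵢ ∘ edge i)
          ∏Δ̂-rel = ~-respˡ (∏Δ̂ l i) (Sum.sum ×₂.commutativeMonoid (Δ̂ (delete i l))) refl
            (~.sum-rel {f = Δ̂ (delete i l)} {h = δᵢ ∘ edge i} (Δ̂-rel i))

        -- The four terms agree by computation; the nested `neg-cong` follow the repeated negations
        -- in `sign`.
        τ₀-tetrahedron : ∀ i → τ₀ (gen (delete i l)) G.≈ tetrahedron (λ j → Δ̂ (delete i l) j)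
        τ₀-tetrahedron i =
          +ᵗ-cong (gen-cong (refl , ∧-cong (refl , refl))) (
          +ᵗ-cong (neg-cong (gen-cong (refl , ∧-cong (refl , refl)))) (
          +ᵗ-cong (neg-cong (neg-cong (gen-cong (refl , ∧-cong (refl , refl))))) (
          +ᵗ-cong (neg-cong (neg-cong (neg-cong (gen-cong (refl , ∧-cong (refl , refl)))))) (
          G.refl))))
          where
          open ModulePresentation using (neg-cong; gen-cong) renaming (+-cong to +ᵗ-cong)
          open AbelianPresentation using () renaming (gen-cong to ∧-cong)

        ∂ᴰ-cyclic : ∀ i → ∂ᴰ (summand (r̂ l i) (∏Δ̂ l i)) G.≈ cyclic (unit (r̂ l i)) (one-minus (r̂ l i)) (∏Δ̂ l i)
        ∂ᴰ-cyclic i = G.refl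

        3τ₀+∂ᴰ≈₂0 : ((altSum G (λ i → τ₀ (gen (delete i l))) G.∙
                      altSum G (λ i → τ₀ (gen (delete i l)))) G.∙
                     altSum G (λ i → τ₀ (gen (delete i l)))) G.∙
                    altSum G (λ i → ∂ᴰ (summand (r̂ l i) (∏Δ̂ l i))) G₂.≈ G₂.ε
        3τ₀+∂ᴰ≈₂0 = square-commutes {A = F×} {G = G} {t = Dlog⊗∧ F 𝒟}
          (Dlog⊗∧-trilinear F 𝒟) (Dlog⊗∧-antisymmetric F 𝒟) (minor l)
          _ _ _ _ Δ̂-rel unit-r̂-rel one-minus-r̂-rel ∏Δ̂-rel _ _ τ₀-tetrahedron ∂ᴰ-cyclic

        altSum-d : ∀ {τ} → IsGroupRelation G (C 4) (Graph G τ) →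
                   altSum G (λ i → τ (gen (delete i l))) G.≈ τ (d (gen l))
        altSum-d {τ} τ-rel = Graph.image (IsGroupRelation.altSum-rel τ-rel τ-graph)
          where
          τ-graph : ∀ i → Graph G τ (τ (gen (delete i l))) (gen (delete i l))
          τ-graph i = graph G.refl

        τ₀-d : altSum G (λ i → τ₀ (gen (delete i l))) G.≈ τ₀ (d (gen l))
        τ₀-d = altSum-d τ₀-rel

        ∂ᴰ-altSum : Graph G ∂ᴰ (altSum G λ i → ∂ᴰ (summand (r̂ l i) (∏Δ̂ l i)))
                               (altSum (source F 𝒟) λ i → summand (r̂ l i) (∏Δ̂ l i))
        ∂ᴰ-altSum = IsGroupRelation.altSum-rel (∂ᴰ-rel F 𝒟) ∂ᴰ-graph
          where
          ∂ᴰ-graph : ∀ i → Graph G ∂ᴰ (∂ᴰ (summand (r̂ l i) (∏Δ̂ l i))) (summand (r̂ l i) (∏Δ̂ l i))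
          ∂ᴰ-graph i = graph G.refl

        module _ (3#0 : 1# + 1# + 1# # 0#) where
          ∂ᴰ-τ₁ : LeftModule._*ₗ_ Target (- val (nonZero (1# + 1# + 1#) 3#0 ⁻¹))
                    (altSum G λ i → ∂ᴰ (summand (r̂ l i) (∏Δ̂ l i))) G.≈ ∂ᴰ (τ₁ 3#0 (gen l))
          ∂ᴰ-τ₁ = Graph.image (∂ᴰ-*ₗ-rel F 𝒟 _ ∂ᴰ-altSum)

          commutes-on-generators : τ₀ (d (gen l)) G₂.≈ ∂ᴰ (τ₁ 3#0 (gen l))
          commutes-on-generators = G₂.trans (≈⇒≈₂ G (G.sym τ₀-d))
            (G₂.trans (3u+v≈₂0⇒u≈₂-⅓v F Target 3#0 _ _ 3τ₀+∂ᴰ≈₂0) (≈⇒≈₂ G ∂ᴰ-τ₁))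

      module _ (3#0 : 1# + 1# + 1# # 0#) where
        private module ∂ᴰ = IsGroupRelation (∂ᴰ-rel F 𝒟)

        -- Chains are formal expressions in configurations and all maps are extended along the group
        -- operations, so induction on the expression reduces the claim to a single configuration.
        commutes : ∀ x → τ₀ (d x) ≈ ∂ᴰ (τ₁ 3#0 x) mod2 LeftModule.+ᴹ-abelianGroup Target
        commutes (gen l)  = commutes-on-generators l 3#0
        commutes 0ᵗ       = ≈⇒≈₂ G (Graph.image ∂ᴰ.ε-rel)
        commutes (s +ᵗ t) = G₂.trans (G₂.∙-cong (commutes s) (commutes t))
          (≈⇒≈₂ G (Graph.image (∂ᴰ.∙-rel {u = τ₁ 3#0 s} {v = τ₁ 3#0 t} (graph G.refl) (graph G.refl))))
        commutes (-ᵗ s)   = G₂.trans (G₂.⁻¹-cong (commutes s))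
          (≈⇒≈₂ G (Graph.image (∂ᴰ.⁻¹-rel {u = τ₁ 3#0 s} (graph G.refl))))

theorem3p10 : ∀ {c ℓ₁ ℓ₂ m ℓm : Level} (F : HeytingField c ℓ₁ ℓ₂) →
    let open Field F in
    (3#0 : 1# + 1# + 1# # 0#) (𝒟 : Derivation) (V₃ : LeftModule ring m ℓm) →
    let open VectorSpace V₃ in
    (B : Basis 3) (ω : VolumeForm) →
    let open WithDerivation 𝒟
        open Geometry B ω
        open Maps 𝒟 in
    (x : AbelianGroup.Carrier (C 5)) →
    τ₀ (d x) ≈ ∂ᴰ (τ₁ 3#0 x) mod2 LeftModule.+ᴹ-abelianGroup Target
theorem3p10 F 3#0 𝒟 V₃ B ω = Commutativity.commutes F V₃ B ω 𝒟 3#0
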